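{- Let $a,b,n$ be positive integers with $a>b$, and define \[ T_0(an,bn,q)'=\sum_{k=an-bn-\lfloor n/2\rfloor}^{an-bn}(-1)^k\begin{bmatrix} an\\ k\end{bmatrix}_{q^2}\begin{bmatrix} 2an-2k\\ an-bn-k\end{bmatrix}. \] Then \[ T_0(an,bn,q)'\equiv(-1)^{an-bn}\begin{bmatrix} an\\ bn\end{bmatrix}_{q^2}\Big\{1-2(a-b)\big(1-\theta_n(q)\big)\Big\}\pmod{\Phi_n(q)^2}, \] where \[ \theta_n(q)=\begin{cases} (-1)^m(1+q^m)q^{m(3m-1)/2}, &\text{if } n=3m,\\ (-1)^mq^{m(3m+1)/2}, &\text{if } n=3m+1,\\ (-1)^{m+1}q^{(m+1)(3m+2)/2}, &\text{if } n=3m+2.\end{cases} \]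
   Context: For integers $n,m$, the $q$-binomial coefficient is $\begin{bmatrix} n\\ m\end{bmatrix}_q=\begin{bmatrix} n\\ m\end{bmatrix}=\frac{(1-q^n)(1-q^{n-1})\cdots(1-q^{n-m+1})}{(1-q)(1-q^2)\cdots(1-q^m)}$ if $0\le m\le n$, and $0$ otherwise; $\begin{bmatrix} n\\ m\end{bmatrix}_{q^2}$ is the same with $q$ replaced by $q^2$. $\Phi_n(q)$ denotes the $n$-th cyclotomic polynomial. $\lfloor x\rfloor$ is the integer part of $x$. For rational functions $A(q),B(q)$, $A\equiv B\pmod{\Phi_n(q)^2}$ means $A-B=\Phi_n(q)^2P(q)/Q(q)$ with $P,Q\in\mathbb{Z}[q]$ and $Q$ coprime to $\Phi_n(q)$. -}

module Defs where

open import Data.Nat as ℕ using (ℕ; zero; suc; _∸_; _<?_; _≤?_)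
open import Data.Nat.Divisibility using (_∣?_)
open import Data.Nat.DivMod using (_/_; _%_)
open import Data.Integer as ℤ using (ℤ; +_; -_; 0ℤ; 1ℤ) renaming (_+_ to _+ℤ_; _*_ to _*ℤ_)
open import Data.List using (List; []; _∷_; reverse; dropWhile; length; replicate; _++_; map; foldr; upTo; filter)
open import Data.List.Relation.Unary.All using (All)
open import Data.Product using (_×_; _,_; proj₁; proj₂; ∃; ∃-syntax)
open import Relation.Nullary using (yes; no; ¬_)
open import Relation.Binary.PropositionalEquality using (_≡_)

-- Polynomials in ℤ[q]: coefficient lists, lowest degree first.
-- Trailing zeros are allowed; equality is taken up to them (_≈P_).

Poly : Set
Poly = List ℤ

infixl 6 _⊕_ _⊖_
infixl 7 _⊗_

_⊕_ : Poly → Poly → Poly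
[] ⊕ q = q
(a ∷ p) ⊕ [] = a ∷ p
(a ∷ p) ⊕ (b ∷ q) = (a +ℤ b) ∷ (p ⊕ q)

scale : ℤ → Poly → Poly
scale c = map (c *ℤ_)

negP : Poly → Poly
negP = scale (- 1ℤ)

_⊖_ : Poly → Poly → Poly
p ⊖ q = p ⊕ negP q

_⊗_ : Poly → Poly → Poly
[] ⊗ q = []
(a ∷ p) ⊗ q = scale a q ⊕ (0ℤ ∷ (p ⊗ q))

const : ℤ → Poly
const c = c ∷ []

X^ : ℕ → Poly
X^ n = replicate n 0ℤ ++ (1ℤ ∷ [])

prodP : List Poly → Poly
prodP = foldr _⊗_ (const 1ℤ)

sumP : List Poly → Poly
sumP = foldr _⊕_ []

spread : Poly → Poly
spread [] = []
spread (a ∷ p) = a ∷ 0ℤ ∷ spread p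

IsZero : Poly → Set
IsZero p = All (_≡ 0ℤ) p

_≈P_ : Poly → Poly → Set
p ≈P q = IsZero (p ⊖ q)

strip : Poly → Poly
strip p = reverse (dropWhile (ℤ._≟ 0ℤ) (reverse p))

leadC : Poly → ℤ
leadC p with reverse p
... | [] = 0ℤ
... | c ∷ _ = c

divMonicAux : ℕ → Poly → Poly → Poly
divMonicAux zero p d = []
divMonicAux (suc f) p d with strip p
... | p' with length p' <? length d
...   | yes _ = []
...   | no _ = (replicate s 0ℤ ++ (c ∷ [])) ⊕ divMonicAux f (p' ⊖ scale c (X^ s ⊗ d)) d
  where
    s = length p' ∸ length d
    c = leadC p'

divMonic : Poly → Poly → Poly
divMonic p d = divMonicAux (length p) p (strip d)

cycs : ℕ → List (ℕ × Poly)
cycs zero = []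
cycs (suc n) =
  (suc n , divMonic (X^ (suc n) ⊖ const 1ℤ)
                    (prodP (map proj₂ (filter (λ e → proj₁ e ∣? suc n) (cycs n)))))
  ∷ cycs n

-- Φ n (Φ 0 is set to 1 by convention; only n ≥ 1 is used)
Φ : ℕ → Poly
Φ n with cycs n
... | [] = const 1ℤ
... | e ∷ _ = proj₂ e

-- q-binomial coefficient [n, m]_q as a polynomial:
-- ∏_{i=0}^{m-1}(1-q^{n-i}) / ∏_{i=1}^{m}(1-q^i)  =  ∏(q^{n-i}-1) / ∏(q^{i}-1)
-- for m ≤ n, and 0 otherwise.

qbinom : ℕ → ℕ → Poly
qbinom n m with m ≤? n
... | yes _ = divMonic (prodP (map (λ i → X^ (n ∸ i) ⊖ const 1ℤ) (upTo m)))
                       (prodP (map (λ i → X^ (suc i) ⊖ const 1ℤ) (upTo m)))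
... | no _ = []

qbinom² : ℕ → ℕ → Poly
qbinom² n m = spread (qbinom n m)

sgn : ℕ → ℤ
sgn zero = 1ℤ
sgn (suc k) = - sgn k

θaux : ℕ → ℕ → Poly
θaux m zero = scale (sgn m) ((const 1ℤ ⊕ X^ m) ⊗ X^ ((m ℕ.* (3 ℕ.* m ∸ 1)) / 2))
θaux m (suc zero) = scale (sgn m) (X^ ((m ℕ.* (3 ℕ.* m ℕ.+ 1)) / 2))
θaux m (suc (suc _)) = scale (sgn (suc m)) (X^ (((m ℕ.+ 1) ℕ.* (3 ℕ.* m ℕ.+ 2)) / 2))

θ : ℕ → Poly
θ n = θaux (n / 3) (n % 3)

rangeℕ : ℕ → ℕ → List ℕ
rangeℕ L U = map (L ℕ.+_) (upTo (suc (U ∸ L)))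

T0' : ℕ → ℕ → ℕ → Poly
T0' a b n = sumP (map term (rangeℕ (a ℕ.* n ∸ b ℕ.* n ∸ n / 2) (a ℕ.* n ∸ b ℕ.* n)))
  where
    term : ℕ → Poly
    term k = scale (sgn k) (qbinom² (a ℕ.* n) k
                            ⊗ qbinom (2 ℕ.* (a ℕ.* n) ∸ 2 ℕ.* k) (a ℕ.* n ∸ b ℕ.* n ∸ k))

RHS : ℕ → ℕ → ℕ → Poly
RHS a b n = scale (sgn (a ℕ.* n ∸ b ℕ.* n))
  (qbinom² (a ℕ.* n) (b ℕ.* n)
   ⊗ (const 1ℤ ⊖ scale (+ (2 ℕ.* (a ∸ b))) (const 1ℤ ⊖ θ n)))

-- Q coprime to M in ℤ[q] (i.e. gcd 1 over ℚ[q]): U Q + V M = c for some nonzero integer c.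
CoprimeP : Poly → Poly → Set
CoprimeP Q M = ∃[ U ] ∃[ V ] ∃[ c ] (¬ (c ≡ 0ℤ) × ((U ⊗ Q ⊕ V ⊗ M) ≈P const c))

-- A ≡ B (mod M):  A - B = M P / Q with P, Q ∈ ℤ[q], Q coprime to M
CongMod : Poly → Poly → Poly → Set
CongMod A B M = ∃[ P ] ∃[ Q ] (CoprimeP Q M × ((Q ⊗ (A ⊖ B)) ≈P (M ⊗ P)))

module Submission where

-- Modulo Φ_n², put k = (a - b) n - j. The terms with j > 0 contain the factor q^(2(a-b)n) - 1 ≡
-- 2 (a - b) (q^n - 1), so their other factors matter only modulo q^n - 1. There the j-th term
-- becomes, up to the common factor, 2 (a - b) times the j-th term of the q-Lucas sum
--   Σ_j (-1)^j q^(j(j-1)/2) (1 - q^n)/(1 - q^(n-j)) [n - j, j] = F n - q^(n-1) F (n-2),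
--   where F n = Σ_j (-1)^j q^(j(j-1)/2) [n - j, j],
-- and F n = - q^(n-2) F (n-3) identifies this sum with θ_n(q). Once the factor
-- q^(2bn+2j) - 1 common to the two binomials is cancelled, the denominators that occur are
-- products of factors q^i - 1 with n ∤ i, which are coprime to Φ_n.
--
-- Polynomial identities are verified pointwise: two coefficient lists agree up to trailing zeros
-- as soon as they take the same values at all integers x > 1. On this range the factors x^i - 1
-- can be cancelled.

open import Defs
open import Data.Nat as ℕ using (ℕ; zero; suc; _<_; _≤_; z≤n; s≤s; s≤s⁻¹)
import Data.Nat.Properties as ℕₚ
open import Data.Nat.Divisibility using (_∣_; _∣?_; divides; ∣⇒≤; ∣-trans; ∣-refl; 0∣⇒≡0; ∣m+n∣m⇒∣n)
open import Data.Nat.DivMod using (_/_; _%_; m*n/n≡m; m≡m%n+[m/n]*n; m%n<n; m/n≤m; m/n*n≤m)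
open import Data.Nat.GCD using (module GCD; module Bézout)
open import Data.Nat.Induction using (<-rec)
import Data.Nat.Tactic.RingSolver as ℕ-Solver
open import Data.Integer as ℤ using (ℤ; 0ℤ; 1ℤ; _+_; _*_; _-_; -_; _^_; ∣_∣)
import Data.Integer.Properties as ℤₚ
open import Data.Integer.Tactic.RingSolver using (solve-∀)
open import Data.List.Base using ([]; _∷_; _++_; _∷ʳ_; length; replicate; map; reverse; dropWhile; filter; applyUpTo; upTo)
import Data.List.Properties as Listₚ
open import Data.List.Relation.Unary.All using ([]; _∷_)
open import Data.Product using (∃-syntax; _×_; _,_; proj₁; proj₂)
open import Data.Sum using (_⊎_; inj₁; inj₂)
open import Function using (_∘_; id)
open import Relation.Nullary using (¬_; yes; no; contradiction)
open import Relation.Binary.Definitions using (tri<; tri≈; tri>)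
open import Relation.Binary.PropositionalEquality using (_≡_; _≢_; refl; sym; trans; cong; cong₂; subst; module ≡-Reasoning)

-- Both `Φ` and `qbinom` are outputs of a long division with fuel, so the exactness of these
-- divisions must be established first. For `qbinom` the Pascal recursion supplies a polynomial
-- quotient. For `Φ` it comes by strong induction from the pairwise coprimality of the Φ_d with d ∣
-- n. That coprimality lives over ℚ: (q^n - 1)/(q^d - 1) is congruent to n/d modulo q^d - 1, so the
-- Bézout constants are integers such as n/d, and division by monic polynomials brings the
-- conclusions back to ℤ[q].
--
-- The common factor q^(2bn+2j) - 1 has to go before the denominators are inspected because of the
-- last term for even n: if 2j = n, it is divisible by q^n - 1 and hence by Φ_n. The other
-- denominator factors are q^i - 1 with i ≤ j and q^(2bn+2i) - 1 with i < j. The cut-off 2j ≤ n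
-- keeps their exponents nonzero modulo n, and it is also where the q-Lucas sum ends.

ev : Poly → ℤ → ℤ
ev []      x = 0ℤ
ev (a ∷ p) x = a + x * ev p x

-- This range is closed under squaring, so identities can be transported along q ↦ q^2, the
-- substitution that `spread` performs.
Big : ℤ → Set
Big x = 1ℤ ℤ.< x

infix 4 _≐_
_≐_ : (ℤ → ℤ) → (ℤ → ℤ) → Set
f ≐ g = ∀ x → Big x → f x ≡ g x

big-* : ∀ {x y} → Big x → Big y → Big (x * y)
big-* (ℤ.+<+ (s≤s (s≤s z≤n))) (ℤ.+<+ (s≤s (s≤s z≤n))) = ℤ.+<+ (s≤s (s≤s z≤n))

big-^ : ∀ {x} n → Big x → Big (x ^ suc n)
big-^ {x} zero    b = subst Big (sym (ℤₚ.*-identityʳ x)) b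
big-^     (suc n) b = big-* b (big-^ n b)

x^n-1≢0 : ∀ {x n} → Big x → 0 < n → x ^ n - 1ℤ ≢ 0ℤ
x^n-1≢0 {x} {suc n} b _ eq = ℤₚ.<-irrefl (sym (ℤₚ.i-j≡0⇒i≡j _ _ eq)) (big-^ n b)

*-≢0 : ∀ {a b} → a ≢ 0ℤ → b ≢ 0ℤ → a * b ≢ 0ℤ
*-≢0 {a} a≢0 b≢0 eq with ℤₚ.i*j≡0⇒i≡0∨j≡0 a eq
... | inj₁ e = a≢0 e
... | inj₂ e = b≢0 e

cancelˡ : ∀ {a b c} → a ≢ 0ℤ → a * b ≡ a * c → b ≡ c
cancelˡ {a} {b} {c} a≢0 = ℤₚ.*-cancelˡ-≡ a b c {{ℤ.≢-nonZero a≢0}}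

-- Evaluation of the operations on coefficient lists

ev-⊕ : ∀ p q x → ev (p ⊕ q) x ≡ ev p x + ev q x
ev-⊕ []      q       x = sym (ℤₚ.+-identityˡ _)
ev-⊕ (a ∷ p) []      x = sym (ℤₚ.+-identityʳ _)
ev-⊕ (a ∷ p) (b ∷ q) x rewrite ev-⊕ p q x = lemma a b x (ev p x) (ev q x)
  where
  lemma : ∀ a b x u v → a + b + x * (u + v) ≡ a + x * u + (b + x * v)
  lemma = solve-∀

ev-scale : ∀ c p x → ev (scale c p) x ≡ c * ev p x
ev-scale c []      x = sym (ℤₚ.*-zeroʳ c)
ev-scale c (a ∷ p) x rewrite ev-scale c p x = lemma c a x (ev p x)
  where
  lemma : ∀ c a x u → c * a + x * (c * u) ≡ c * (a + x * u)
  lemma = solve-∀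

ev-⊖ : ∀ p q x → ev (p ⊖ q) x ≡ ev p x - ev q x
ev-⊖ p q x rewrite ev-⊕ p (negP q) x | ev-scale (- 1ℤ) q x =
  cong (ev p x +_) (ℤₚ.-1*i≡-i (ev q x))

ev-⊗ : ∀ p q x → ev (p ⊗ q) x ≡ ev p x * ev q x
ev-⊗ []      q x = refl
ev-⊗ (a ∷ p) q x
  rewrite ev-⊕ (scale a q) (0ℤ ∷ p ⊗ q) x | ev-scale a q x | ev-⊗ p q x = lemma a x (ev p x) (ev q x)
  where
  lemma : ∀ a x u v → a * v + (0ℤ + x * (u * v)) ≡ (a + x * u) * v
  lemma = solve-∀

ev-const : ∀ c x → ev (const c) x ≡ c
ev-const c x = trans (cong (c +_) (ℤₚ.*-zeroʳ x)) (ℤₚ.+-identityʳ c)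

ev-++ : ∀ p q x → ev (p ++ q) x ≡ ev p x + x ^ length p * ev q x
ev-++ []      q x = lemma (ev q x)
  where
  lemma : ∀ v → v ≡ 0ℤ + 1ℤ * v
  lemma = solve-∀
ev-++ (a ∷ p) q x rewrite ev-++ p q x = lemma a x (ev p x) (x ^ length p) (ev q x)
  where
  lemma : ∀ a x u k v → a + x * (u + k * v) ≡ a + x * u + x * k * v
  lemma = solve-∀

ev-∷ʳ : ∀ p c x → ev (p ∷ʳ c) x ≡ ev p x + c * x ^ length p
ev-∷ʳ p c x = trans (ev-++ p (const c) x)
  (cong (ev p x +_) (trans (cong (x ^ length p *_) (ev-const c x)) (ℤₚ.*-comm (x ^ length p) c)))

ev-shift : ∀ n p x → ev (replicate n 0ℤ ++ p) x ≡ x ^ n * ev p x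
ev-shift zero    p x = sym (ℤₚ.*-identityˡ _)
ev-shift (suc n) p x rewrite ev-shift n p x = lemma x (x ^ n) (ev p x)
  where
  lemma : ∀ x k u → 0ℤ + x * (k * u) ≡ x * k * u
  lemma = solve-∀

ev-X^ : ∀ n x → ev (X^ n) x ≡ x ^ n
ev-X^ n x = trans (ev-shift n (const 1ℤ) x) (trans (cong (x ^ n *_) (ev-const 1ℤ x)) (ℤₚ.*-identityʳ _))

ev-X^-1 : ∀ n x → ev (X^ n ⊖ const 1ℤ) x ≡ x ^ n - 1ℤ
ev-X^-1 n x = trans (ev-⊖ (X^ n) (const 1ℤ) x) (cong₂ _-_ (ev-X^ n x) (ev-const 1ℤ x))

ev-spread : ∀ p x → ev (spread p) x ≡ ev p (x * x)
ev-spread []      x = refl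
ev-spread (a ∷ p) x rewrite ev-spread p x = lemma a x (ev p (x * x))
  where
  lemma : ∀ a x u → a + x * (0ℤ + x * u) ≡ a + x * x * u
  lemma = solve-∀

-- Coefficients and degrees recovered from values

constant-term : ∀ a (f : ℤ → ℤ) → (λ x → a + x * f x) ≐ (λ _ → 0ℤ) → a ≡ 0ℤ
constant-term a f h = byValue ∣ f x ∣ refl
  where
  -- At this x the hypothesis makes a a multiple of x, while x exceeds ∣ a ∣; hence a = 0. Adding 2
  -- keeps x > 1 even for a = 0.
  x = ℤ.+ suc (suc ∣ a ∣)
  a≡ : ∣ a ∣ ≡ suc (suc ∣ a ∣) ℕ.* ∣ f x ∣
  a≡ = trans (cong ∣_∣ (ℤₚ.i-j≡0⇒i≡j a (- (x * f x)) (trans (cong (a +_) (ℤₚ.neg-involutive _)) (h x (ℤ.+<+ (s≤s (s≤s z≤n)))))))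
         (trans (ℤₚ.∣-i∣≡∣i∣ (x * f x)) (ℤₚ.abs-* x (f x)))
  byValue : ∀ k → ∣ f x ∣ ≡ k → a ≡ 0ℤ
  byValue zero    e = ℤₚ.∣i∣≡0⇒i≡0 (trans a≡ (trans (cong (suc (suc ∣ a ∣) ℕ.*_) e) (ℕₚ.*-zeroʳ ∣ a ∣)))
  byValue (suc k) e = contradiction
    (ℕₚ.≤-trans (ℕₚ.m≤m*n (suc (suc ∣ a ∣)) (suc k))
      (ℕₚ.≤-reflexive (sym (trans a≡ (cong (suc (suc ∣ a ∣) ℕ.*_) e)))))
    (ℕₚ.<⇒≱ (ℕₚ.m<n⇒m<1+n (ℕₚ.n<1+n _)))

higher-terms : ∀ {f : ℤ → ℤ} → (λ x → 0ℤ + x * f x) ≐ (λ _ → 0ℤ) → f ≐ (λ _ → 0ℤ)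
higher-terms {f} h x b with ℤₚ.i*j≡0⇒i≡0∨j≡0 x (trans (sym (ℤₚ.+-identityˡ _)) (h x b))
... | inj₂ e = e
... | inj₁ refl = contradiction b λ { (ℤ.+<+ ()) }

ev≐0⇒IsZero : ∀ p → ev p ≐ (λ _ → 0ℤ) → IsZero p
ev≐0⇒IsZero []      h = []
ev≐0⇒IsZero (a ∷ p) h with constant-term a (ev p) h
... | refl = refl ∷ ev≐0⇒IsZero p (higher-terms h)

≐⇒≈P : ∀ p q → ev p ≐ ev q → p ≈P q
≐⇒≈P p q h = ev≐0⇒IsZero (p ⊖ q) λ x b → trans (ev-⊖ p q x) (ℤₚ.i≡j⇒i-j≡0 (h x b))

-- Degrees are handled through lengths: a list of length at most k stands for a polynomial of degree
-- below k, which cannot cancel c x^k. Removing the constant term and dividing by x lowers k by one.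
leading-term : ∀ p k c → length p ≤ k → (λ x → ev p x + c * x ^ k) ≐ (λ _ → 0ℤ) → c ≡ 0ℤ
leading-term [] zero c l h = trans (lemma c) (h (ℤ.+ 2) (ℤ.+<+ (s≤s (s≤s z≤n))))
  where
  lemma : ∀ c → c ≡ 0ℤ + c * 1ℤ
  lemma = solve-∀
leading-term [] (suc k) c l h = leading-term [] k c z≤n (higher-terms λ x b → trans (lemma c x (x ^ k)) (h x b))
  where
  lemma : ∀ c x u → 0ℤ + x * (0ℤ + c * u) ≡ 0ℤ + c * (x * u)
  lemma = solve-∀
leading-term (a ∷ p) (suc k) c (s≤s l) h = leading-term p k c l (higher-terms h″)
  where
  lemma : ∀ a c x u v → a + x * (u + c * v) ≡ a + x * u + c * (x * v)
  lemma = solve-∀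
  h′ : (λ x → a + x * (ev p x + c * x ^ k)) ≐ (λ _ → 0ℤ)
  h′ x b = trans (lemma a c x (ev p x) (x ^ k)) (h x b)
  h″ : (λ x → 0ℤ + x * (ev p x + c * x ^ k)) ≐ (λ _ → 0ℤ)
  h″ x b = trans (cong (_+ x * (ev p x + c * x ^ k)) (sym (constant-term a _ h′))) (h′ x b)

length-⊕ : ∀ p q k → length p ≤ k → length q ≤ k → length (p ⊕ q) ≤ k
length-⊕ []      q       k       l m = m
length-⊕ (a ∷ p) []      k       l m = l
length-⊕ (a ∷ p) (b ∷ q) (suc k) (s≤s l) (s≤s m) = s≤s (length-⊕ p q k l m)

length-scale : ∀ c p → length (scale c p) ≡ length p
length-scale c p = Listₚ.length-map (c *_) p

length-⊖ : ∀ p q k → length p ≤ k → length q ≤ k → length (p ⊖ q) ≤ k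
length-⊖ p q k l m = length-⊕ p (negP q) k l (subst (_≤ k) (sym (length-scale (- 1ℤ) q)) m)

length-⊗ : ∀ p q → length (p ⊗ q) ≤ length p ℕ.+ length q
length-⊗ []      q = z≤n
length-⊗ (a ∷ p) q = length-⊕ (scale a q) (0ℤ ∷ p ⊗ q) _
  (subst (_≤ _) (sym (length-scale a q)) (ℕₚ.m≤n+m (length q) (suc (length p))))
  (s≤s (length-⊗ p q))

length-shift : ∀ n p → length (replicate n 0ℤ ++ p) ≡ n ℕ.+ length p
length-shift n p = trans (Listₚ.length-++ (replicate n 0ℤ)) (cong (ℕ._+ length p) (Listₚ.length-replicate n))

leading-terms-agree : ∀ p q c d k → length p ≤ k → length q ≤ k →
  (λ x → ev p x + c * x ^ k) ≐ (λ x → ev q x + d * x ^ k) → c ≡ d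
leading-terms-agree p q c d k l m h = ℤₚ.i-j≡0⇒i≡j c d (leading-term (p ⊖ q) k (c - d) (length-⊖ p q k l m) h′)
  where
  lemma : ∀ u v c d y → u - v + (c - d) * y ≡ (u + c * y) - (v + d * y)
  lemma = solve-∀
  h′ : (λ x → ev (p ⊖ q) x + (c - d) * x ^ k) ≐ (λ _ → 0ℤ)
  h′ x b rewrite ev-⊖ p q x = trans (lemma (ev p x) (ev q x) c d (x ^ k)) (ℤₚ.i≡j⇒i-j≡0 (h x b))

degree-too-small : ∀ p q c k → length p ≤ k → length q ≤ k → (λ x → ev p x + c * x ^ k) ≐ ev q → c ≡ 0ℤ
degree-too-small p q c k l m h = leading-terms-agree p q c 0ℤ k l m
  λ x b → trans (h x b) (lemma (ev q x) (x ^ k))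
  where
  lemma : ∀ v y → v ≡ v + 0ℤ * y
  lemma = solve-∀

-- Division by monic polynomials

record Stripped (q : Poly) : Set where
  constructor stripped
  field
    {body} : Poly
    {lead} : ℤ
    snoc   : q ≡ body ∷ʳ lead
    lead≢0 : lead ≢ 0ℤ

strip-ev : ∀ p x → ev (strip p) x ≡ ev p x
strip-ev p x = trans (lemma (reverse p)) (cong (λ r → ev r x) (Listₚ.reverse-involutive p))
  where
  lemma : ∀ r → ev (reverse (dropWhile (ℤ._≟ 0ℤ) r)) x ≡ ev (reverse r) x
  lemma []      = refl
  lemma (a ∷ r) with a ℤ.≟ 0ℤ
  ... | no  _    = refl
  ... | yes refl = trans (lemma r) (sym (trans (cong (λ s → ev s x) (Listₚ.unfold-reverse 0ℤ r))
                     (trans (ev-∷ʳ (reverse r) 0ℤ x) (ℤₚ.+-identityʳ _))))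

strip-view : ∀ p → strip p ≡ [] ⊎ Stripped (strip p)
strip-view p = lemma (reverse p)
  where
  lemma : ∀ r → reverse (dropWhile (ℤ._≟ 0ℤ) r) ≡ [] ⊎ Stripped (reverse (dropWhile (ℤ._≟ 0ℤ) r))
  lemma []      = inj₁ refl
  lemma (a ∷ r) with a ℤ.≟ 0ℤ
  ... | yes _   = lemma r
  ... | no  a≢0 = inj₂ (stripped (Listₚ.unfold-reverse a r) a≢0)

leadC-∷ʳ : ∀ u c → leadC (u ∷ʳ c) ≡ c
leadC-∷ʳ u c rewrite Listₚ.reverse-++ u (c ∷ []) = refl

length-∷ʳ : ∀ (u : Poly) c → length (u ∷ʳ c) ≡ suc (length u)
length-∷ʳ u c = trans (Listₚ.length-++ u) (ℕₚ.+-comm (length u) 1)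

-- A nonzero last coefficient cannot be matched by a list too short to reach its degree, so
-- stripping yields the shortest list with the given values. This is what bounds the fuel of the
-- division.
length-strip : ∀ p q → ev p ≐ ev q → length (strip p) ≤ length q
length-strip p q h with strip-view p
... | inj₁ e rewrite e = z≤n
... | inj₂ (stripped {u} {c} e c≢0) rewrite e | length-∷ʳ u c with ℕₚ.≤-<-connex (length q) (length u)
...   | inj₂ u<q = u<q
...   | inj₁ q≤u = contradiction
        (degree-too-small u q c (length u) ℕₚ.≤-refl q≤u λ x b →
          trans (sym (ev-∷ʳ u c x)) (trans (cong (λ r → ev r x) (sym e)) (trans (strip-ev p x) (h x b))))
        c≢0

-- A condition on values rather than on the list, hence insensitive to trailing zeros.
record Monic (p : Poly) : Set where
  constructor monic
  field
    low    : Poly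
    deg    : ℕ
    low≤   : length low ≤ deg
    ev≐    : ev p ≐ (λ x → ev low x + x ^ deg)

-- The degrees k and l may differ a priori. If they did, the larger power would stand, with
-- coefficient 1 or c, against lists too short to cancel it, contrary to 1 ≠ 0 or c ≠ 0.
leading-unique : ∀ p q c k l → length p ≤ k → length q ≤ l → c ≢ 0ℤ →
  (λ x → ev p x + c * x ^ k) ≐ (λ x → ev q x + x ^ l) → c ≡ 1ℤ
leading-unique p q c k l p≤k q≤l c≢0 h = byDegree (ℕₚ.<-cmp k l)
  where
  h′ : (λ x → ev p x + c * x ^ k) ≐ (λ x → ev q x + 1ℤ * x ^ l)
  h′ x b = trans (h x b) (cong (ev q x +_) (sym (ℤₚ.*-identityˡ _)))
  extend : ∀ {m n} r d → length r ≤ m → m < n → length (r ⊕ scale d (X^ m)) ≤ n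
  extend {m} {n} r d r≤m m<n = length-⊕ r (scale d (X^ m)) n (ℕₚ.≤-trans r≤m (ℕₚ.<⇒≤ m<n))
    (subst (_≤ n) (sym (trans (length-scale d (X^ m)) (trans (length-shift m (1ℤ ∷ [])) (ℕₚ.+-comm m 1)))) m<n)
  ev-extend : ∀ m r d x → ev r x + d * x ^ m ≡ ev (r ⊕ scale d (X^ m)) x
  ev-extend m r d x = sym (trans (ev-⊕ r (scale d (X^ m)) x)
    (cong (ev r x +_) (trans (ev-scale d (X^ m) x) (cong (d *_) (ev-X^ m x)))))
  byDegree : _ → c ≡ 1ℤ
  byDegree (tri≈ _ eq _) = leading-terms-agree p q c 1ℤ l (subst (length p ≤_) eq p≤k) q≤l
    (subst (λ m → (λ x → ev p x + c * x ^ m) ≐ (λ x → ev q x + 1ℤ * x ^ l)) eq h′)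
  byDegree (tri< k<l _ _) = contradiction
    (degree-too-small q (p ⊕ scale c (X^ k)) 1ℤ l q≤l (extend p c p≤k k<l)
      λ x b → trans (sym (h′ x b)) (ev-extend k p c x))
    λ ()
  byDegree (tri> _ _ l<k) = contradiction
    (degree-too-small p (q ⊕ scale 1ℤ (X^ l)) c k p≤k (extend q 1ℤ q≤l l<k)
      λ x b → trans (h′ x b) (ev-extend l q 1ℤ x))
    c≢0

strip-snoc : ∀ p {u c} → strip p ≡ u ∷ʳ c → ∀ x → ev p x ≡ ev u x + c * x ^ length u
strip-snoc p {u} {c} e x = trans (sym (strip-ev p x)) (trans (cong (λ r → ev r x) e) (ev-∷ʳ u c x))

strip-nil : ∀ p → strip p ≡ [] → ev p ≐ (λ _ → 0ℤ)
strip-nil p e x b = trans (sym (strip-ev p x)) (cong (λ r → ev r x) e)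

monic≢0 : ∀ {p} → Monic p → ¬ (ev p ≐ (λ _ → 0ℤ))
monic≢0 (monic w k w≤k h) z = contradiction
  (leading-term w k 1ℤ w≤k λ x b → trans (cong (ev w x +_) (ℤₚ.*-identityˡ _)) (trans (sym (h x b)) (z x b)))
  λ ()

monic-strip : ∀ p → Monic p → ∃[ w ] strip p ≡ w ∷ʳ 1ℤ
monic-strip p m@(monic w k w≤k h) with strip-view p
... | inj₁ e = contradiction (strip-nil p e) (monic≢0 m)
... | inj₂ (stripped {u} {c} e c≢0) = u , trans e (cong (u ∷ʳ_)
        (leading-unique u w c (length u) k ℕₚ.≤-refl w≤k c≢0 λ x b → trans (sym (strip-snoc p e x)) (h x b)))

-- One step of long division: subtracting c X^s (w + X^|w|) from u + c X^|u|
-- cancels the leading terms.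
division-step : ∀ u w c s → length u ≡ s ℕ.+ length w →
  length (strip ((u ∷ʳ c) ⊖ scale c (X^ s ⊗ (w ∷ʳ 1ℤ)))) ≤ length u
division-step u w c s l = ℕₚ.≤-trans
  (length-strip ((u ∷ʳ c) ⊖ scale c (X^ s ⊗ (w ∷ʳ 1ℤ))) (u ⊖ scale c (replicate s 0ℤ ++ w)) λ x _ → agree x)
  (length-⊖ u (scale c (replicate s 0ℤ ++ w)) _ ℕₚ.≤-refl
    (ℕₚ.≤-reflexive (trans (length-scale c (replicate s 0ℤ ++ w)) (trans (length-shift s w) (sym l)))))
  where
  lemma : ∀ e f c a b → e + c * (a * b) - c * (a * (f + 1ℤ * b)) ≡ e - c * (a * f)
  lemma = solve-∀
  agree : ∀ x → ev ((u ∷ʳ c) ⊖ scale c (X^ s ⊗ (w ∷ʳ 1ℤ))) x ≡ ev (u ⊖ scale c (replicate s 0ℤ ++ w)) x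
  agree x
    rewrite ev-⊖ (u ∷ʳ c) (scale c (X^ s ⊗ (w ∷ʳ 1ℤ))) x | ev-⊖ u (scale c (replicate s 0ℤ ++ w)) x
          | ev-scale c (X^ s ⊗ (w ∷ʳ 1ℤ)) x | ev-scale c (replicate s 0ℤ ++ w) x
          | ev-⊗ (X^ s) (w ∷ʳ 1ℤ) x | ev-X^ s x | ev-shift s w x
          | ev-∷ʳ u c x | ev-∷ʳ w 1ℤ x | l | ℤₚ.^-distribˡ-+-* x s (length w)
    = lemma (ev u x) (ev w x) c (x ^ s) (x ^ length w)

-- The invariant is that the fuel is at least the length of the stripped dividend. By
-- `division-step` each round shortens that list, so fuel 0 is met only with a zero dividend.
divMonicAux-correct : ∀ f p w → length (strip p) ≤ f → ∃[ r ] length r ≤ length w ×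
  (∀ x → ev p x ≡ ev (w ∷ʳ 1ℤ) x * ev (divMonicAux f p (w ∷ʳ 1ℤ)) x + ev r x)
divMonicAux-correct zero p w l with strip-view p
... | inj₁ e = [] , z≤n , λ x →
      trans (sym (strip-ev p x)) (trans (cong (λ r → ev r x) e)
        (sym (trans (ℤₚ.+-identityʳ _) (ℤₚ.*-zeroʳ (ev (w ∷ʳ 1ℤ) x)))))
... | inj₂ (stripped {u} {c} e _) = contradiction
      (subst (_≤ 0) (trans (cong length e) (length-∷ʳ u c)) l) λ ()
divMonicAux-correct (suc f) p w l with strip p | strip-view p | (λ x → strip-ev p x)
... | p′ | view | p′≡p with length p′ ℕ.<? length (w ∷ʳ 1ℤ)
...   | yes p′<d = p′ , s≤s⁻¹ (subst (length p′ <_) (length-∷ʳ w 1ℤ) p′<d) , λ x →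
        trans (sym (p′≡p x)) (sym (trans (cong (_+ ev p′ x) (ℤₚ.*-zeroʳ (ev (w ∷ʳ 1ℤ) x))) (ℤₚ.+-identityˡ _)))
...   | no p′≮d with view
...     | inj₁ refl = contradiction (subst (0 <_) (sym (length-∷ʳ w 1ℤ)) (s≤s z≤n)) p′≮d
...     | inj₂ (stripped {u} {c} refl _) = proj₁ rec , proj₁ (proj₂ rec) , λ x → begin
          ev p x                                   ≡⟨ p′≡p x ⟨
          ev (u ∷ʳ c) x                            ≡⟨ lemma₁ (ev (u ∷ʳ c) x) (ev (scale c′ (X^ s ⊗ (w ∷ʳ 1ℤ))) x) ⟩
          ev (u ∷ʳ c) x - ev (scale c′ (X^ s ⊗ (w ∷ʳ 1ℤ))) x + ev (scale c′ (X^ s ⊗ (w ∷ʳ 1ℤ))) x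
            ≡⟨ cong₂ _+_ (sym (ev-⊖ (u ∷ʳ c) (scale c′ (X^ s ⊗ (w ∷ʳ 1ℤ))) x))
                 (trans (ev-scale c′ (X^ s ⊗ (w ∷ʳ 1ℤ)) x) (cong (c′ *_) (trans (ev-⊗ (X^ s) (w ∷ʳ 1ℤ) x)
                    (cong (_* ev (w ∷ʳ 1ℤ) x) (ev-X^ s x))))) ⟩
          ev rest x + c′ * (x ^ s * ev (w ∷ʳ 1ℤ) x)
            ≡⟨ cong (_+ c′ * (x ^ s * ev (w ∷ʳ 1ℤ) x)) (proj₂ (proj₂ rec) x) ⟩
          ev (w ∷ʳ 1ℤ) x * ev q x + ev (proj₁ rec) x + c′ * (x ^ s * ev (w ∷ʳ 1ℤ) x)
            ≡⟨ lemma₂ (ev (w ∷ʳ 1ℤ) x) (ev q x) (ev (proj₁ rec) x) c′ (x ^ s) ⟩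
          ev (w ∷ʳ 1ℤ) x * (x ^ s * c′ + ev q x) + ev (proj₁ rec) x
            ≡⟨ cong (λ t → ev (w ∷ʳ 1ℤ) x * t + ev (proj₁ rec) x) (sym (trans (ev-⊕ (replicate s 0ℤ ++ const c′) q x)
                 (cong (_+ ev q x) (trans (ev-shift s (const c′) x) (cong (x ^ s *_) (ev-const c′ x)))))) ⟩
          ev (w ∷ʳ 1ℤ) x * ev ((replicate s 0ℤ ++ const c′) ⊕ q) x + ev (proj₁ rec) x ∎
  where
  open ≡-Reasoning
  s = length (u ∷ʳ c) ℕ.∸ length (w ∷ʳ 1ℤ)
  c′ = leadC (u ∷ʳ c)
  rest = (u ∷ʳ c) ⊖ scale c′ (X^ s ⊗ (w ∷ʳ 1ℤ))
  q = divMonicAux f rest (w ∷ʳ 1ℤ)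
  u≡ : length u ≡ s ℕ.+ length w
  u≡ = ℕₚ.suc-injective (trans (sym (length-∷ʳ u c)) (trans (sym (ℕₚ.m∸n+n≡m (ℕₚ.≮⇒≥ p′≮d)))
         (trans (cong (s ℕ.+_) (length-∷ʳ w 1ℤ)) (ℕₚ.+-suc s (length w)))))
  bound : length (strip rest) ≤ f
  bound = ℕₚ.≤-trans
    (subst (λ e → length (strip ((u ∷ʳ c) ⊖ scale e (X^ s ⊗ (w ∷ʳ 1ℤ)))) ≤ length u) (sym (leadC-∷ʳ u c))
      (division-step u w c s u≡))
    (s≤s⁻¹ (subst (_≤ suc f) (length-∷ʳ u c) l))
  rec = divMonicAux-correct f rest w bound
  lemma₁ : ∀ a b → a ≡ a - b + b
  lemma₁ = solve-∀
  lemma₂ : ∀ d q r c y → d * q + r + c * (y * d) ≡ d * (y * c + q) + r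
  lemma₂ = solve-∀

leading-product : ∀ w u c k l → length w ≤ k → length u ≤ l → ∃[ f ] length f ≤ k ℕ.+ l ×
  (∀ x → (ev w x + x ^ k) * (ev u x + c * x ^ l) ≡ ev f x + c * x ^ (k ℕ.+ l))
leading-product w u c k l w≤k u≤l = f , f≤ , agree
  where
  f₁ = w ⊗ u
  f₂ = replicate k 0ℤ ++ u
  f₃ = scale c (replicate l 0ℤ ++ w)
  f = f₁ ⊕ f₂ ⊕ f₃
  f≤ : length f ≤ k ℕ.+ l
  f≤ = length-⊕ (f₁ ⊕ f₂) f₃ _
    (length-⊕ f₁ f₂ _ (ℕₚ.≤-trans (length-⊗ w u) (ℕₚ.+-mono-≤ w≤k u≤l))
      (subst (_≤ k ℕ.+ l) (sym (length-shift k u)) (ℕₚ.+-monoʳ-≤ k u≤l)))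
    (subst (_≤ k ℕ.+ l) (sym (trans (length-scale c (replicate l 0ℤ ++ w)) (trans (length-shift l w) (ℕₚ.+-comm l (length w)))))
      (ℕₚ.+-monoˡ-≤ l w≤k))
  lemma : ∀ w u c a b → (w + a) * (u + c * b) ≡ w * u + a * u + c * (b * w) + c * (a * b)
  lemma = solve-∀
  agree : ∀ x → (ev w x + x ^ k) * (ev u x + c * x ^ l) ≡ ev f x + c * x ^ (k ℕ.+ l)
  agree x
    rewrite ev-⊕ (f₁ ⊕ f₂) f₃ x | ev-⊕ f₁ f₂ x | ev-⊗ w u x | ev-shift k u x
          | ev-scale c (replicate l 0ℤ ++ w) x | ev-shift l w x | ℤₚ.^-distribˡ-+-* x k l
    = lemma (ev w x) (ev u x) c (x ^ k) (x ^ l)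

-- A last nonzero coefficient c of e, in degree l, would give the product a term c x^(k + l) beyond
-- the reach of r. The uniqueness of quotient and remainder rests on this.
short-multiple : ∀ w k e r → length w ≤ k → length r ≤ k →
  (λ x → (ev w x + x ^ k) * ev e x) ≐ ev r → ev e ≐ (λ _ → 0ℤ)
short-multiple w k e r w≤k r≤k h with strip-view e
... | inj₁ z = strip-nil e z
... | inj₂ (stripped {u} {c} z c≢0) with leading-product w u c k (length u) w≤k ℕₚ.≤-refl
...   | f , f≤ , eq = contradiction
        (degree-too-small f r c (k ℕ.+ length u) f≤ (ℕₚ.≤-trans r≤k (ℕₚ.m≤m+n k _))
          λ x b → trans (sym (eq x)) (trans (cong ((ev w x + x ^ k) *_) (sym (strip-snoc e z x))) (h x b)))
        c≢0

record Division (p d : Poly) : Set where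
  constructor division
  field
    low rem  : Poly
    rem≤     : length rem ≤ length low
    divisor  : ∀ x → ev d x ≡ ev low x + x ^ length low
    dividend : ∀ x → ev p x ≡ ev d x * ev (divMonic p d) x + ev rem x

divMonic-division : ∀ p d → Monic d → Division p d
divMonic-division p d m with strip d in eq | monic-strip d m
... | _ | w , refl with divMonicAux-correct (length p) p w (length-strip p p (λ _ _ → refl))
...   | r , r≤w , rem = division w r r≤w
        (λ x → trans (d≡ x) (trans (ev-∷ʳ w 1ℤ x) (cong (ev w x +_) (ℤₚ.*-identityˡ _))))
        λ x → trans (rem x) (cong₂ (λ a q → a * ev q x + ev r x) (sym (d≡ x)) (cong (divMonicAux (length p) p) (sym eq)))
  where
  d≡ : ∀ x → ev d x ≡ ev (w ∷ʳ 1ℤ) x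
  d≡ x = trans (sym (strip-ev d x)) (cong (λ t → ev t x) eq)

-- The constant c allows for divisibility that is only known over ℚ.
descent : ∀ p d s c → c ≢ 0ℤ → Monic d → (λ x → c * ev p x) ≐ (λ x → ev d x * ev s x) →
  ev p ≐ (λ x → ev d x * ev (divMonic p d) x) × (λ x → c * ev (divMonic p d) x) ≐ ev s
descent p d s c c≢0 m h with divMonic-division p d m
... | division w r r≤ d≡ rem = exact , quotient
  where
  q = divMonic p d
  e = s ⊖ scale c q
  ev-e : ∀ x → ev e x ≡ ev s x - c * ev q x
  ev-e x = trans (ev-⊖ s (scale c q) x) (cong (λ t → ev s x - t) (ev-scale c q x))
  lemma : ∀ c d q r s → c * (d * q + r) ≡ d * s → d * (s - c * q) ≡ c * r
  lemma c d q r s eq = trans (distrib d s c q) (trans (cong (_- c * (d * q)) (sym eq)) (collect c d q r))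
    where
    distrib : ∀ d s c q → d * (s - c * q) ≡ d * s - c * (d * q)
    distrib = solve-∀
    collect : ∀ c d q r → c * (d * q + r) - c * (d * q) ≡ c * r
    collect = solve-∀
  -- From c p = d s and p = d q + r follows d (s - c q) = c r. As r is shorter than d,
  -- `short-multiple` forces both sides to vanish.
  de≡cr : (λ x → ev d x * ev e x) ≐ (λ x → c * ev r x)
  de≡cr x b = trans (cong (ev d x *_) (ev-e x))
    (lemma c (ev d x) (ev q x) (ev r x) (ev s x) (trans (cong (c *_) (sym (rem x))) (h x b)))
  e≡0 : ev e ≐ (λ _ → 0ℤ)
  e≡0 = short-multiple w (length w) e (scale c r) ℕₚ.≤-refl (subst (_≤ length w) (sym (length-scale c r)) r≤)
    λ x b → trans (cong (_* ev e x) (sym (d≡ x))) (trans (de≡cr x b) (sym (ev-scale c r x)))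
  r≡0 : ev r ≐ (λ _ → 0ℤ)
  r≡0 x b = cancelˡ c≢0 (trans (sym (de≡cr x b))
    (trans (cong (ev d x *_) (e≡0 x b)) (trans (ℤₚ.*-zeroʳ (ev d x)) (sym (ℤₚ.*-zeroʳ c)))))
  exact : ev p ≐ (λ x → ev d x * ev q x)
  exact x b = trans (rem x) (trans (cong (ev d x * ev q x +_) (r≡0 x b)) (ℤₚ.+-identityʳ _))
  quotient : (λ x → c * ev q x) ≐ ev s
  quotient x b = sym (ℤₚ.i-j≡0⇒i≡j _ _ (trans (sym (ev-e x)) (e≡0 x b)))

divMonic-exact : ∀ p d s → Monic d → ev p ≐ (λ x → ev d x * ev s x) → ev (divMonic p d) ≐ ev s
divMonic-exact p d s m h x b = trans (sym (ℤₚ.*-identityˡ _))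
  (proj₂ (descent p d s 1ℤ (λ ()) m λ y b → trans (ℤₚ.*-identityˡ _) (h y b)) x b)

monic-⊗ : ∀ {p q} → Monic p → Monic q → Monic (p ⊗ q)
monic-⊗ {p} {q} (monic w k w≤ p≡) (monic u l u≤ q≡) with leading-product w u 1ℤ k l w≤ u≤
... | f , f≤ , eq = monic f (k ℕ.+ l) f≤ λ x b →
      trans (ev-⊗ p q x) (trans (cong₂ _*_ (p≡ x b) (trans (q≡ x b) (cong (ev u x +_) (sym (ℤₚ.*-identityˡ _)))))
        (trans (eq x) (cong (ev f x +_) (ℤₚ.*-identityˡ _))))

-- As d is monic, s and p have the same leading coefficient.
monic-quotient : ∀ {p d s} → Monic p → Monic d → ev p ≐ (λ x → ev d x * ev s x) → Monic s
monic-quotient {p} {d} {s} mp@(monic v n v≤ p≡) (monic w k w≤ d≡) h with strip-view s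
... | inj₁ z = contradiction
      (λ x b → trans (h x b) (trans (cong (ev d x *_) (strip-nil s z x b)) (ℤₚ.*-zeroʳ (ev d x))))
      (monic≢0 mp)
... | inj₂ (stripped {u} {c} z c≢0) with leading-product w u c k (length u) w≤ ℕₚ.≤-refl
...   | f , f≤ , eq = monic u (length u) ℕₚ.≤-refl λ x b →
        trans (strip-snoc s z x) (cong (ev u x +_) (trans (cong (_* x ^ length u) c≡1) (ℤₚ.*-identityˡ _)))
  where
  c≡1 : c ≡ 1ℤ
  c≡1 = leading-unique f v c (k ℕ.+ length u) n f≤ v≤ c≢0 λ x b →
    trans (sym (eq x)) (trans (cong₂ _*_ (sym (d≡ x b)) (sym (strip-snoc s z x))) (trans (sym (h x b)) (p≡ x b)))

monic-1 : Monic (const 1ℤ)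
monic-1 = monic [] 0 z≤n λ x b → trans (ev-const 1ℤ x) refl

monic-X^-1 : ∀ n → Monic (X^ (suc n) ⊖ const 1ℤ)
monic-X^-1 n = monic (const (- 1ℤ)) (suc n) (s≤s z≤n) λ x b →
  trans (ev-X^-1 (suc n) x) (trans (ℤₚ.+-comm (x ^ suc n) (- 1ℤ)) (cong (_+ x ^ suc n) (sym (ev-const (- 1ℤ) x))))

-- Polynomials are treated as functions from here on, which puts their identities within reach of
-- the ring solver over ℤ. The witnessing list is kept because `CongMod` asks for coefficient lists.
IsPoly : (ℤ → ℤ) → Set
IsPoly f = ∃[ p ] ev p ≐ f

poly-ev : ∀ p → IsPoly (ev p)
poly-ev p = p , λ _ _ → refl

poly-const : ∀ c → IsPoly (λ _ → c)
poly-const c = const c , λ x _ → ev-const c x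

poly-^ : ∀ n → IsPoly (λ x → x ^ n)
poly-^ n = X^ n , λ x _ → ev-X^ n x

poly-+ : ∀ {f g} → IsPoly f → IsPoly g → IsPoly (λ x → f x + g x)
poly-+ (p , p≡) (q , q≡) = p ⊕ q , λ x b → trans (ev-⊕ p q x) (cong₂ _+_ (p≡ x b) (q≡ x b))

poly-sub : ∀ {f g} → IsPoly f → IsPoly g → IsPoly (λ x → f x - g x)
poly-sub (p , p≡) (q , q≡) = p ⊖ q , λ x b → trans (ev-⊖ p q x) (cong₂ _-_ (p≡ x b) (q≡ x b))

poly-* : ∀ {f g} → IsPoly f → IsPoly g → IsPoly (λ x → f x * g x)
poly-* (p , p≡) (q , q≡) = p ⊗ q , λ x b → trans (ev-⊗ p q x) (cong₂ _*_ (p≡ x b) (q≡ x b))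

poly-² : ∀ {f} → IsPoly f → IsPoly (λ x → f (x * x))
poly-² (p , p≡) = spread p , λ x b → trans (ev-spread p x) (p≡ (x * x) (big-* b b))

-- Gaussian binomial coefficients

-- This is (-1)^n (x; x)_n, a q-factorial without its denominator (x - 1)^n; `rise x m j` is a
-- quotient of two of these.
fac : ℤ → ℕ → ℤ
fac x zero    = 1ℤ
fac x (suc n) = fac x n * (x ^ suc n - 1ℤ)

rise : ℤ → ℕ → ℕ → ℤ
rise x m zero    = 1ℤ
rise x m (suc j) = rise x m j * (x ^ (m ℕ.+ suc j) - 1ℤ)

fac≢0 : ∀ {x} n → Big x → fac x n ≢ 0ℤ
fac≢0 zero    b = λ ()
fac≢0 (suc n) b = *-≢0 (fac≢0 n b) (x^n-1≢0 {n = suc n} b (s≤s z≤n))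

fac-rise : ∀ x m j → fac x m * rise x m j ≡ fac x (m ℕ.+ j)
fac-rise x m zero    = trans (ℤₚ.*-identityʳ _) (cong (fac x) (sym (ℕₚ.+-identityʳ m)))
fac-rise x m (suc j) = begin
  fac x m * (rise x m j * (x ^ (m ℕ.+ suc j) - 1ℤ))   ≡⟨ ℤₚ.*-assoc (fac x m) _ _ ⟨
  fac x m * rise x m j * (x ^ (m ℕ.+ suc j) - 1ℤ)     ≡⟨ cong₂ (λ f n → f * (x ^ n - 1ℤ)) (fac-rise x m j) (ℕₚ.+-suc m j) ⟩
  fac x (suc (m ℕ.+ j))                                ≡⟨ cong (fac x) (ℕₚ.+-suc m j) ⟨
  fac x (m ℕ.+ suc j)                                  ∎
  where open ≡-Reasoning

poly-^-1 : ∀ n → IsPoly (λ x → x ^ n - 1ℤ)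
poly-^-1 n = poly-sub (poly-^ n) (poly-const 1ℤ)

poly-fac : ∀ n → IsPoly (λ x → fac x n)
poly-fac zero    = poly-const 1ℤ
poly-fac (suc n) = poly-* (poly-fac n) (poly-^-1 (suc n))

poly-rise : ∀ m j → IsPoly (λ x → rise x m j)
poly-rise m zero    = poly-const 1ℤ
poly-rise m (suc j) = poly-* (poly-rise m j) (poly-^-1 (m ℕ.+ suc j))

-- diag x n j is the Gaussian binomial coefficient [n - j, j], which vanishes for n < 2 j.
diag : ℤ → ℕ → ℕ → ℤ
diag x n             zero    = 1ℤ
diag x zero          (suc j) = 0ℤ
diag x (suc zero)    (suc j) = 0ℤ
diag x (suc (suc n)) (suc j) = diag x n j + x ^ suc j * diag x (suc n) (suc j)

poly-diag : ∀ n j → IsPoly (λ x → diag x n j)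
poly-diag n             zero    = poly-const 1ℤ
poly-diag zero          (suc j) = poly-const 0ℤ
poly-diag (suc zero)    (suc j) = poly-const 0ℤ
poly-diag (suc (suc n)) (suc j) = poly-+ (poly-diag n j) (poly-* (poly-^ (suc j)) (poly-diag (suc n) (suc j)))

infixl 6 _+2*_
-- r + 2 j, built two successors at a time so that `diag x (r +2* suc j) (suc j)` unfolds along the
-- recursion of `diag`.
_+2*_ : ℕ → ℕ → ℕ
r +2* zero  = r
r +2* suc j = suc (suc (r +2* j))

suc-+2* : ∀ r j → suc r +2* j ≡ suc (r +2* j)
suc-+2* r zero    = refl
suc-+2* r (suc j) = cong (suc ∘ suc) (suc-+2* r j)

+2*-correct : ∀ r j → r +2* j ≡ r ℕ.+ j ℕ.+ j
+2*-correct r zero    = sym (trans (ℕₚ.+-identityʳ _) (ℕₚ.+-identityʳ r))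
+2*-correct r (suc j) = trans (cong (suc ∘ suc) (+2*-correct r j))
  (sym (trans (ℕₚ.+-suc (r ℕ.+ suc j) j) (cong (λ n → suc (n ℕ.+ j)) (ℕₚ.+-suc r j))))

diag-vanishes : ∀ x n j → n < 0 +2* j → diag x n j ≡ 0ℤ
diag-vanishes x zero          (suc j) l = refl
diag-vanishes x (suc zero)    (suc j) l = refl
diag-vanishes x (suc (suc n)) (suc j) (s≤s (s≤s l)) = cong₂ _+_ (diag-vanishes x n j l)
  (trans (cong (x ^ suc j *_) (diag-vanishes x (suc n) (suc j) (s≤s (ℕₚ.m≤n⇒m≤1+n l)))) (ℤₚ.*-zeroʳ (x ^ suc j)))

diag-fac-0 : ∀ x j → fac x j * diag x (0 +2* j) j ≡ fac x j
diag-fac-0 x zero    = refl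
diag-fac-0 x (suc j) = begin
  fac x j * (J - 1ℤ) * (d + J * diag x (suc (0 +2* j)) (suc j))
    ≡⟨ cong (λ z → fac x j * (J - 1ℤ) * (d + J * z)) (diag-vanishes x (suc (0 +2* j)) (suc j) (ℕₚ.n<1+n _)) ⟩
  fac x j * (J - 1ℤ) * (d + J * 0ℤ)
    ≡⟨ lemma (fac x j) d J ⟩
  fac x j * d * (J - 1ℤ)
    ≡⟨ cong (_* (J - 1ℤ)) (diag-fac-0 x j) ⟩
  fac x (suc j) ∎
  where
  open ≡-Reasoning
  J = x ^ suc j
  d = diag x (0 +2* j) j
  lemma : ∀ f d p → f * (p - 1ℤ) * (d + p * 0ℤ) ≡ f * d * (p - 1ℤ)
  lemma = solve-∀

-- Both Pascal terms reduce, by induction, to multiples of one factorial, and (J - 1) + J (R - 1) =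
-- R J - 1 supplies the factor that is missing.
diag-fac : ∀ x r j → fac x r * fac x j * diag x (r +2* j) j ≡ fac x (r ℕ.+ j)
diag-fac x r zero = trans (ℤₚ.*-identityʳ _) (trans (ℤₚ.*-identityʳ _) (cong (fac x) (sym (ℕₚ.+-identityʳ r))))
diag-fac x zero (suc j) = trans (cong (_* diag x (0 +2* suc j) (suc j)) (ℤₚ.*-identityˡ (fac x (suc j)))) (diag-fac-0 x (suc j))
diag-fac x (suc r) (suc j) = begin
  fac x r * (R - 1ℤ) * (fac x j * (J - 1ℤ)) * (d₁ + J * d₂)
    ≡⟨ lemma (fac x r) (fac x j) R J d₁ d₂ ⟩
  (J - 1ℤ) * (fac x r * (R - 1ℤ) * fac x j * d₁) + J * (R - 1ℤ) * (fac x r * (fac x j * (J - 1ℤ)) * d₂)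
    ≡⟨ cong₂ (λ u v → (J - 1ℤ) * u + J * (R - 1ℤ) * v) (diag-fac x (suc r) j) second ⟩
  (J - 1ℤ) * F + J * (R - 1ℤ) * F
    ≡⟨ lemma′ F R J ⟩
  F * (R * J - 1ℤ)
    ≡⟨ cong (λ p → F * (p - 1ℤ)) (sym (ℤₚ.^-distribˡ-+-* x (suc r) (suc j))) ⟩
  F * (x ^ (suc r ℕ.+ suc j) - 1ℤ)
    ≡⟨ cong (λ n → fac x n * (x ^ (suc r ℕ.+ suc j) - 1ℤ)) (sym (ℕₚ.+-suc r j)) ⟩
  fac x (suc r ℕ.+ suc j) ∎
  where
  open ≡-Reasoning
  R = x ^ suc r
  J = x ^ suc j
  F = fac x (suc r ℕ.+ j)
  d₁ = diag x (suc r +2* j) j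
  d₂ = diag x (suc (suc r +2* j)) (suc j)
  second : fac x r * fac x (suc j) * d₂ ≡ F
  second = trans (cong (λ n → fac x r * fac x (suc j) * diag x (suc n) (suc j)) (suc-+2* r j))
    (trans (diag-fac x r (suc j)) (cong (fac x) (ℕₚ.+-suc r j)))
  lemma : ∀ r j R J a b → r * (R - 1ℤ) * (j * (J - 1ℤ)) * (a + J * b) ≡
    (J - 1ℤ) * (r * (R - 1ℤ) * j * a) + J * (R - 1ℤ) * (r * (j * (J - 1ℤ)) * b)
  lemma = solve-∀
  lemma′ : ∀ F R J → (J - 1ℤ) * F + J * (R - 1ℤ) * F ≡ F * (R * J - 1ℤ)
  lemma′ = solve-∀

ev-prodP-∷ʳ : ∀ ps p x → ev (prodP (ps ∷ʳ p)) x ≡ ev (prodP ps) x * ev p x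
ev-prodP-∷ʳ [] p x = trans (ev-⊗ p (const 1ℤ) x) (ℤₚ.*-comm (ev p x) _)
ev-prodP-∷ʳ (q ∷ ps) p x = begin
  ev (q ⊗ prodP (ps ∷ʳ p)) x           ≡⟨ ev-⊗ q (prodP (ps ∷ʳ p)) x ⟩
  ev q x * ev (prodP (ps ∷ʳ p)) x      ≡⟨ cong (ev q x *_) (ev-prodP-∷ʳ ps p x) ⟩
  ev q x * (ev (prodP ps) x * ev p x)  ≡⟨ ℤₚ.*-assoc (ev q x) _ _ ⟨
  ev q x * ev (prodP ps) x * ev p x    ≡⟨ cong (_* ev p x) (sym (ev-⊗ q (prodP ps) x)) ⟩
  ev (q ⊗ prodP ps) x * ev p x         ∎
  where open ≡-Reasoning

monic-prodP : ∀ (f : ℕ → Poly) m → (∀ i → Monic (f i)) → Monic (prodP (applyUpTo f m))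
monic-prodP f zero    h = monic-1
monic-prodP f (suc m) h = monic-⊗ (h 0) (monic-prodP (f ∘ suc) m (h ∘ suc))

ev-denominator : ∀ x m → ev (prodP (applyUpTo (λ i → X^ (suc i) ⊖ const 1ℤ) m)) x ≡ fac x m
ev-denominator x zero    = ev-const 1ℤ x
ev-denominator x (suc m) = begin
  ev (prodP (applyUpTo f (suc m))) x       ≡⟨ cong (λ l → ev (prodP l) x) (sym (Listₚ.applyUpTo-∷ʳ f m)) ⟩
  ev (prodP (applyUpTo f m ∷ʳ f m)) x      ≡⟨ ev-prodP-∷ʳ (applyUpTo f m) (f m) x ⟩
  ev (prodP (applyUpTo f m)) x * ev (f m) x ≡⟨ cong₂ _*_ (ev-denominator x m) (ev-X^-1 (suc m) x) ⟩
  fac x (suc m)                            ∎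
  where
  open ≡-Reasoning
  f : ℕ → Poly
  f i = X^ (suc i) ⊖ const 1ℤ

ev-numerator : ∀ x k m →
  fac x k * ev (prodP (applyUpTo (λ i → X^ (k ℕ.+ m ℕ.∸ i) ⊖ const 1ℤ) m)) x ≡ fac x (k ℕ.+ m)
ev-numerator x k zero    = trans (cong (fac x k *_) (ev-const 1ℤ x)) (trans (ℤₚ.*-identityʳ _) (cong (fac x) (sym (ℕₚ.+-identityʳ k))))
ev-numerator x k (suc m) rewrite ℕₚ.+-suc k m = begin
  fac x k * ev (f ⊗ rest) x          ≡⟨ cong (fac x k *_) (ev-⊗ f rest x) ⟩
  fac x k * (ev f x * ev rest x)     ≡⟨ lemma (fac x k) (ev f x) (ev rest x) ⟩
  fac x k * ev rest x * ev f x       ≡⟨ cong₂ _*_ (ev-numerator x k m) (ev-X^-1 (suc (k ℕ.+ m)) x) ⟩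
  fac x (suc (k ℕ.+ m))              ∎
  where
  open ≡-Reasoning
  f = X^ (suc (k ℕ.+ m)) ⊖ const 1ℤ
  rest = prodP (applyUpTo (λ i → X^ (k ℕ.+ m ℕ.∸ i) ⊖ const 1ℤ) m)
  lemma : ∀ a b c → a * (b * c) ≡ a * c * b
  lemma = solve-∀

-- `diag` is a polynomial by construction. Its factorial formula, after cancellation of `fac x k`,
-- shows that it is the quotient of numerator by denominator, so the division is exact and returns
-- it.
qbinom-fac : ∀ k m {x} → Big x → fac x k * fac x m * ev (qbinom (k ℕ.+ m) m) x ≡ fac x (k ℕ.+ m)
qbinom-fac k m {x} b with m ℕ.≤? k ℕ.+ m
... | no m≰k+m = contradiction (ℕₚ.m≤n+m m k) m≰k+m
... | yes _ rewrite Listₚ.map-applyUpTo id (λ i → X^ (k ℕ.+ m ℕ.∸ i) ⊖ const 1ℤ) m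
                  | Listₚ.map-applyUpTo id (λ i → X^ (suc i) ⊖ const 1ℤ) m =
  trans (cong (fac x k * fac x m *_) (trans (divMonic-exact num den g den-monic exact x b) (g≡ x b))) (diag-fac x k m)
  where
  num = prodP (applyUpTo (λ i → X^ (k ℕ.+ m ℕ.∸ i) ⊖ const 1ℤ) m)
  den = prodP (applyUpTo (λ i → X^ (suc i) ⊖ const 1ℤ) m)
  den-monic : Monic den
  den-monic = monic-prodP (λ i → X^ (suc i) ⊖ const 1ℤ) m monic-X^-1
  g = proj₁ (poly-diag (k +2* m) m)
  g≡ = proj₂ (poly-diag (k +2* m) m)
  exact : ev num ≐ (λ y → ev den y * ev g y)
  exact y b = cancelˡ (fac≢0 k b) (trans (ev-numerator y k m) (trans (sym (diag-fac y k m))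
    (trans (ℤₚ.*-assoc (fac y k) _ _) (cong₂ (λ u v → fac y k * (u * v)) (sym (ev-denominator y m)) (sym (g≡ y b))))))

-- Divisibility and coprimality of polynomial functions

infix 4 _∣ᶠ_
_∣ᶠ_ : (ℤ → ℤ) → (ℤ → ℤ) → Set
f ∣ᶠ g = ∃[ k ] IsPoly k × (g ≐ λ x → f x * k x)

∣ᶠ-trans : ∀ {f g h} → f ∣ᶠ g → g ∣ᶠ h → f ∣ᶠ h
∣ᶠ-trans {f} (k , k-poly , k≡) (l , l-poly , l≡) = (λ x → k x * l x) , poly-* k-poly l-poly ,
  λ x b → trans (l≡ x b) (trans (cong (_* l x) (k≡ x b)) (ℤₚ.*-assoc (f x) (k x) (l x)))

-- Coprimality over ℚ: the constant of the Bézout identity need not be 1.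
record Coprime (f g : ℤ → ℤ) : Set where
  constructor coprime
  field
    {u v}  : ℤ → ℤ
    u-poly : IsPoly u
    v-poly : IsPoly v
    c      : ℤ
    c≢0    : c ≢ 0ℤ
    bezout : (λ x → u x * f x + v x * g x) ≐ (λ _ → c)

coprime-sym : ∀ {f g} → Coprime f g → Coprime g f
coprime-sym {f} {g} (coprime {u} {v} pu pv c c≢0 bz) = coprime pv pu c c≢0 λ x b → trans (ℤₚ.+-comm (v x * g x) (u x * f x)) (bz x b)

coprime-1 : ∀ {g} → Coprime (λ _ → 1ℤ) g
coprime-1 {g} = coprime (poly-const 1ℤ) (poly-const 0ℤ) 1ℤ (λ ()) λ x b → lemma (g x)
  where
  lemma : ∀ t → 1ℤ * 1ℤ + 0ℤ * t ≡ 1ℤ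
  lemma = solve-∀

-- The product of the two Bézout identities, with every term that contains h collected in the second
-- coefficient.
coprime-* : ∀ {f g h} → IsPoly f → IsPoly g → IsPoly h → Coprime f h → Coprime g h → Coprime (λ x → f x * g x) h
coprime-* {f} {g} {h} pf pg ph (coprime {u} {v} pu pv c c≢0 bz) (coprime {u′} {v′} pu′ pv′ c′ c′≢0 bz′) =
  coprime (poly-* pu pu′)
    (poly-+ (poly-+ (poly-* (poly-* pu pf) pv′) (poly-* (poly-* pv pu′) pg)) (poly-* (poly-* pv pv′) ph))
    (c * c′) (*-≢0 c≢0 c′≢0)
    λ x b → trans (lemma (u x) (v x) (u′ x) (v′ x) (f x) (g x) (h x)) (cong₂ _*_ (bz x b) (bz′ x b))
  where
  lemma : ∀ u v u′ v′ f g h →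
    u * u′ * (f * g) + (u * f * v′ + v * u′ * g + v * v′ * h) * h ≡ (u * f + v * h) * (u′ * g + v′ * h)
  lemma = solve-∀

coprime-∣ : ∀ {f g h} → f ∣ᶠ g → Coprime g h → Coprime f h
coprime-∣ {f} {g} {h} (k , k-poly , k≡) (coprime {u} {v} pu pv c c≢0 bz) =
  coprime (poly-* pu k-poly) pv c c≢0 λ x b → trans (cong (_+ v x * h x)
    (trans (lemma (u x) (k x) (f x)) (cong (u x *_) (sym (k≡ x b))))) (bz x b)
  where
  lemma : ∀ u k f → u * k * f ≡ u * (f * k)
  lemma = solve-∀

coprime-≐ : ∀ {f g h} → f ≐ g → Coprime f h → Coprime g h
coprime-≐ {h = h} e (coprime {u} {v} pu pv c c≢0 bz) = coprime pu pv c c≢0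
  λ x b → trans (cong (λ t → u x * t + v x * h x) (sym (e x b))) (bz x b)

-- (w + 1)^e - 1 to second order in w = x^d - 1
power-expansion : ∀ d e → ∃[ k ] IsPoly k ×
  (∀ x → x ^ (e ℕ.* d) - 1ℤ ≡ (x ^ d - 1ℤ) * (ℤ.+ e + (x ^ d - 1ℤ) * k x))
power-expansion d zero    = (λ _ → 0ℤ) , poly-const 0ℤ , λ x → lemma (x ^ d)
  where
  lemma : ∀ y → 1ℤ - 1ℤ ≡ (y - 1ℤ) * (0ℤ + (y - 1ℤ) * 0ℤ)
  lemma = solve-∀
power-expansion d (suc e) with power-expansion d e
... | k , k-poly , k≡ = (λ x → k x + ℤ.+ e + (x ^ d - 1ℤ) * k x) ,
      poly-+ (poly-+ k-poly (poly-const (ℤ.+ e))) (poly-* (poly-^-1 d) k-poly) , λ x → begin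
        x ^ (d ℕ.+ e ℕ.* d) - 1ℤ                              ≡⟨ cong (_- 1ℤ) (ℤₚ.^-distribˡ-+-* x d (e ℕ.* d)) ⟩
        x ^ d * x ^ (e ℕ.* d) - 1ℤ                            ≡⟨ lemma₁ (x ^ d) (x ^ (e ℕ.* d)) ⟩
        x ^ d * (x ^ (e ℕ.* d) - 1ℤ) + (x ^ d - 1ℤ)           ≡⟨ cong (λ t → x ^ d * t + (x ^ d - 1ℤ)) (k≡ x) ⟩
        x ^ d * ((x ^ d - 1ℤ) * (ℤ.+ e + (x ^ d - 1ℤ) * k x)) + (x ^ d - 1ℤ)
          ≡⟨ lemma₂ (x ^ d) (ℤ.+ e) (k x) ⟩
        (x ^ d - 1ℤ) * (1ℤ + ℤ.+ e + (x ^ d - 1ℤ) * (k x + ℤ.+ e + (x ^ d - 1ℤ) * k x)) ∎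
  where
  open ≡-Reasoning
  lemma₁ : ∀ a b → a * b - 1ℤ ≡ a * (b - 1ℤ) + (a - 1ℤ)
  lemma₁ = solve-∀
  lemma₂ : ∀ a e k → a * ((a - 1ℤ) * (e + (a - 1ℤ) * k)) + (a - 1ℤ) ≡
    (a - 1ℤ) * (1ℤ + e + (a - 1ℤ) * (k + e + (a - 1ℤ) * k))
  lemma₂ = solve-∀

x^d-1∣x^ed-1 : ∀ d e → (λ x → x ^ d - 1ℤ) ∣ᶠ (λ x → x ^ (e ℕ.* d) - 1ℤ)
x^d-1∣x^ed-1 d e with power-expansion d e
... | k , k-poly , k≡ = (λ x → ℤ.+ e + (x ^ d - 1ℤ) * k x) ,
      poly-+ (poly-const (ℤ.+ e)) (poly-* (poly-^-1 d) k-poly) , λ x _ → k≡ x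

x^-1-mono-∣ : ∀ {d n} → d ∣ n → (λ x → x ^ d - 1ℤ) ∣ᶠ (λ x → x ^ n - 1ℤ)
x^-1-mono-∣ {d} (divides e refl) = x^d-1∣x^ed-1 d e

-- Cyclotomic polynomials

-- The last field says that p divides (x^n - 1)/(x^d - 1) for each proper divisor d. With the second
-- field it makes p coprime to x^i - 1 whenever n ∤ i.
record Cyclotomic (n : ℕ) (p : Poly) : Set where
  field
    is-monic  : Monic p
    ∣x^n-1    : ev p ∣ᶠ (λ x → x ^ n - 1ℤ)
    proper-∣  : ∀ {d} → d ∣ n → d < n → (λ x → ev p x * (x ^ d - 1ℤ)) ∣ᶠ (λ x → x ^ n - 1ℤ)

-- If d + c n = a i, then x^d - 1 = (x^(a i) - 1) - x^d (x^(c n) - 1), where the brackets are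
-- multiples of x^i - 1 and x^n - 1.
x^gcd-1 : ∀ {d i n} → Bézout.Identity d i n → ∃[ u ] ∃[ v ] IsPoly u × IsPoly v ×
  (λ x → x ^ d - 1ℤ) ≐ (λ x → u x * (x ^ i - 1ℤ) + v x * (x ^ n - 1ℤ))
x^gcd-1 {d} {i} {n} (Bézout.+- a c eq) with x^d-1∣x^ed-1 i a | x^d-1∣x^ed-1 n c
... | k , k-poly , k≡ | l , l-poly , l≡ =
      k , (λ x → 0ℤ - x ^ d * l x) , k-poly , poly-sub (poly-const 0ℤ) (poly-* (poly-^ d) l-poly) , λ x b → begin
        x ^ d - 1ℤ                                              ≡⟨ lemma₁ (x ^ d) (x ^ (c ℕ.* n)) ⟩
        x ^ d * x ^ (c ℕ.* n) - 1ℤ - x ^ d * (x ^ (c ℕ.* n) - 1ℤ)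
          ≡⟨ cong₂ (λ t s → t - 1ℤ - x ^ d * s) (trans (sym (ℤₚ.^-distribˡ-+-* x d (c ℕ.* n))) (cong (x ^_) eq)) (l≡ x b) ⟩
        x ^ (a ℕ.* i) - 1ℤ - x ^ d * ((x ^ n - 1ℤ) * l x)        ≡⟨ cong (_- x ^ d * ((x ^ n - 1ℤ) * l x)) (k≡ x b) ⟩
        (x ^ i - 1ℤ) * k x - x ^ d * ((x ^ n - 1ℤ) * l x)
          ≡⟨ lemma₂ (x ^ i - 1ℤ) (x ^ n - 1ℤ) (k x) (l x) (x ^ d) ⟩
        k x * (x ^ i - 1ℤ) + (0ℤ - x ^ d * l x) * (x ^ n - 1ℤ)   ∎
  where
  open ≡-Reasoning
  lemma₁ : ∀ d c → d - 1ℤ ≡ d * c - 1ℤ - d * (c - 1ℤ)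
  lemma₁ = solve-∀
  lemma₂ : ∀ i n k l d → i * k - d * (n * l) ≡ k * i + (0ℤ - d * l) * n
  lemma₂ = solve-∀
x^gcd-1 {d} {i} {n} (Bézout.-+ a c eq) with x^gcd-1 {d} {n} {i} (Bézout.+- c a eq)
... | u , v , pu , pv , h = v , u , pv , pu , λ x b → trans (h x b) (ℤₚ.+-comm (u x * (x ^ n - 1ℤ)) (v x * (x ^ i - 1ℤ)))

-- Let d = gcd(i, n), a proper divisor of n, and e = n/d. Then (x^n - 1)/(x^d - 1) is a multiple of
-- p and congruent to the constant e modulo x^d - 1. Since x^d - 1 is a combination of x^i - 1 and
-- x^n - 1, the latter a multiple of p, a Bézout identity with constant e results.
x^i-1-coprime : ∀ {n p i} → Cyclotomic n p → 0 < n → ¬ n ∣ i → Coprime (λ x → x ^ i - 1ℤ) (ev p)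
x^i-1-coprime {n} {p} {i} cyc 0<n n∤i with Bézout.lemma i n
... | Bézout.result d g identity = byQuotient (GCD.gcd∣n g)
  where
  d<n : d < n
  d<n = ℕₚ.≤∧≢⇒< (∣⇒≤ {{ℕ.>-nonZero 0<n}} (GCD.gcd∣n g)) λ eq → n∤i (subst (_∣ i) eq (GCD.gcd∣m g))
  byQuotient : d ∣ n → Coprime (λ x → x ^ i - 1ℤ) (ev p)
  byQuotient d∣n@(divides e refl) with x^gcd-1 identity | power-expansion d e | Cyclotomic.∣x^n-1 cyc | Cyclotomic.proper-∣ cyc d∣n d<n
  ...   | u , v , pu , pv , uv≡ | k , k-poly , k≡ | q , q-poly , q≡ | r , r-poly , r≡ =
    coprime (poly-sub (poly-const 0ℤ) (poly-* k-poly pu)) (poly-sub r-poly (poly-* (poly-* k-poly pv) q-poly)) (ℤ.+ e) e≢0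
      λ x b → begin
        (0ℤ - k x * u x) * (x ^ i - 1ℤ) + (r x - k x * v x * q x) * ev p x
          ≡⟨ lemma₁ (k x) (u x) (v x) (q x) (r x) (x ^ i - 1ℤ) (ev p x) ⟩
        ev p x * r x - k x * (u x * (x ^ i - 1ℤ) + v x * (ev p x * q x))
          ≡⟨ cong₂ (λ s t → s - k x * (u x * (x ^ i - 1ℤ) + v x * t)) (pr≡ x b) (sym (q≡ x b)) ⟩
        ℤ.+ e + (x ^ d - 1ℤ) * k x - k x * (u x * (x ^ i - 1ℤ) + v x * (x ^ n - 1ℤ))
          ≡⟨ cong (λ t → ℤ.+ e + (x ^ d - 1ℤ) * k x - k x * t) (sym (uv≡ x b)) ⟩
        ℤ.+ e + (x ^ d - 1ℤ) * k x - k x * (x ^ d - 1ℤ)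
          ≡⟨ lemma₂ (ℤ.+ e) (x ^ d - 1ℤ) (k x) ⟩
        ℤ.+ e ∎
    where
    open ≡-Reasoning
    e≢0 : ℤ.+ e ≢ 0ℤ
    e≢0 e≡0 = ℕₚ.<-irrefl (sym (cong (ℕ._* d) (ℤₚ.+-injective e≡0))) 0<n
    0<d : 0 < d
    0<d = ℕₚ.n≢0⇒n>0 λ d≡0 → ℕₚ.<-irrefl (sym (trans (cong (e ℕ.*_) d≡0) (ℕₚ.*-zeroʳ e))) 0<n
    lemma₁ : ∀ k u v q r i p → (0ℤ - k * u) * i + (r - k * v * q) * p ≡ p * r - k * (u * i + v * (p * q))
    lemma₁ = solve-∀
    lemma₂ : ∀ e d k → e + d * k - k * d ≡ e
    lemma₂ = solve-∀
    lemma₃ : ∀ d p r → p * d * r ≡ d * (p * r)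
    lemma₃ = solve-∀
    pr≡ : (λ x → ev p x * r x) ≐ (λ x → ℤ.+ e + (x ^ d - 1ℤ) * k x)
    pr≡ x b = cancelˡ (x^n-1≢0 {n = d} b 0<d)
      (trans (sym (lemma₃ (x ^ d - 1ℤ) (ev p x) (r x))) (trans (sym (r≡ x b)) (k≡ x)))

-- The filter is that of `cycs`, so `Φ (suc m)` is by definition `divMonic` of q^(m+1) - 1 by
-- `cyclotomic-product (suc m) m`.
cyclotomic-product : ℕ → ℕ → Poly
cyclotomic-product n k = prodP (map proj₂ (filter (λ e → proj₁ e ∣? n) (cycs k)))

product-accept : ∀ {n k} → suc k ∣ n → cyclotomic-product n (suc k) ≡ Φ (suc k) ⊗ cyclotomic-product n k
product-accept {n} {k} k∣n = cong (λ l → prodP (map proj₂ l)) (Listₚ.filter-accept (λ e → proj₁ e ∣? n) k∣n)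

product-reject : ∀ {n k} → ¬ suc k ∣ n → cyclotomic-product n (suc k) ≡ cyclotomic-product n k
product-reject {n} {k} k∤n = cong (λ l → prodP (map proj₂ l)) (Listₚ.filter-reject (λ e → proj₁ e ∣? n) k∤n)

record Factorisation (m : ℕ) : Set where
  field
    cyclotomic : Cyclotomic (suc m) (Φ (suc m))
    product    : ev (cyclotomic-product (suc m) (suc m)) ≐ (λ x → x ^ suc m - 1ℤ)

module _ (m : ℕ) (ih : ∀ {k} → k < m → Factorisation k) where

  private
    n = suc m

    Π : ℕ → Poly
    Π = cyclotomic-product n

    cyc : ∀ {k} → k < m → Cyclotomic (suc k) (Φ (suc k))
    cyc k<m = Factorisation.cyclotomic (ih k<m)

  -- Each factor Φ_d has 0 < d < k + 1, so k + 1 ∤ d, and Φ_d divides x^d - 1, which is coprime to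
  -- Φ_(k+1).
  Φ-coprime-product : ∀ {k} l → k < m → l ≤ k → Coprime (ev (Π l)) (ev (Φ (suc k)))
  Φ-coprime-product zero k<m l≤k = coprime-≐ (λ x _ → sym (ev-const 1ℤ x)) coprime-1
  Φ-coprime-product {k} (suc l) k<m l<k with suc l ∣? n
  ... | no  l∤n rewrite product-reject l∤n = Φ-coprime-product l k<m (ℕₚ.<⇒≤ l<k)
  ... | yes l∣n rewrite product-accept l∣n =
    coprime-≐ (λ x _ → sym (ev-⊗ (Φ (suc l)) (Π l) x))
      (coprime-* (poly-ev (Φ (suc l))) (poly-ev (Π l)) (poly-ev (Φ (suc k)))
        (coprime-∣ (Cyclotomic.∣x^n-1 (cyc (ℕₚ.<-trans l<k k<m)))
          (x^i-1-coprime (cyc k<m) (s≤s z≤n) λ k∣l → ℕₚ.<⇒≱ l<k (s≤s⁻¹ (∣⇒≤ k∣l))))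
        (Φ-coprime-product l k<m (ℕₚ.<⇒≤ l<k)))

  -- Coprime divisors of x^n - 1 have a product dividing it, but a Bézout constant c gives this only
  -- for c (x^n - 1). The product is monic, so `descent` removes c.
  product-∣ : ∀ k → k ≤ m → Monic (Π k) × ev (Π k) ∣ᶠ (λ x → x ^ n - 1ℤ)
  product-∣ zero k≤m = monic-1 , (λ x → x ^ n - 1ℤ) , poly-^-1 n ,
    λ x _ → sym (trans (cong (_* (x ^ n - 1ℤ)) (ev-const 1ℤ x)) (ℤₚ.*-identityˡ _))
  product-∣ (suc k) k<m with suc k ∣? n | product-∣ k (ℕₚ.<⇒≤ k<m)
  ... | no  k∤n | rec rewrite product-reject k∤n = rec
  ... | yes k∣n | mon , (b , b-poly , b≡) rewrite product-accept k∣n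
      with ∣ᶠ-trans {ev (Φ (suc k))} (Cyclotomic.∣x^n-1 (cyc k<m)) (x^-1-mono-∣ k∣n) | Φ-coprime-product k k<m ℕₚ.≤-refl
  ...   | a , a-poly , a≡ | coprime {u} {v} pu pv c c≢0 bz with poly-+ (poly-* pu a-poly) (poly-* pv b-poly)
  ...     | s , s≡ = mon′ , ev (divMonic X D) , poly-ev (divMonic X D) ,
            λ x big → trans (sym (ev-X^-1 n x)) (proj₁ (descent X D s c c≢0 mon′ h) x big)
    where
    X = X^ n ⊖ const 1ℤ
    D = Φ (suc k) ⊗ Π k
    mon′ : Monic D
    mon′ = monic-⊗ (Cyclotomic.is-monic (cyc k<m)) mon
    lemma : ∀ u v t h X a b → X ≡ h * a → X ≡ t * b → (u * t + v * h) * X ≡ h * t * (u * a + v * b)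
    lemma u v t h X a b e₁ e₂ = trans (expand u v t h X) (trans (cong₂ (λ y z → u * t * y + v * h * z) e₁ e₂) (collect u v t h a b))
      where
      expand : ∀ u v t h X → (u * t + v * h) * X ≡ u * t * X + v * h * X
      expand = solve-∀
      collect : ∀ u v t h a b → u * t * (h * a) + v * h * (t * b) ≡ h * t * (u * a + v * b)
      collect = solve-∀
    h : (λ x → c * ev X x) ≐ (λ x → ev D x * ev s x)
    h x big = trans (cong₂ _*_ (sym (bz x big)) (ev-X^-1 n x))
      (trans (lemma (u x) (v x) (ev (Π k) x) (ev (Φ (suc k)) x) _ (a x) (b x) (a≡ x big) (b≡ x big))
        (sym (cong₂ _*_ (ev-⊗ (Φ (suc k)) (Π k) x) (s≡ x big))))

  Φ-product : ev (Φ n ⊗ Π m) ≐ (λ x → x ^ n - 1ℤ)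
  Φ-product with product-∣ m ℕₚ.≤-refl
  ... | mon , (b , (s , s≡) , b≡) = λ x big → trans (ev-⊗ (Φ n) (Π m) x)
        (trans (cong (_* ev (Π m) x) (divMonic-exact (X^ n ⊖ const 1ℤ) (Π m) s mon
            (λ y big′ → trans (ev-X^-1 n y) (trans (b≡ y big′) (cong (ev (Π m) y *_) (sym (s≡ y big′))))) x big))
          (trans (ℤₚ.*-comm (ev s x) _) (trans (cong (ev (Π m) x *_) (s≡ x big)) (sym (b≡ x big)))))

  product-∣-product : ∀ {d} → d ∣ n → ∀ k → ev (cyclotomic-product d k) ∣ᶠ ev (Π k)
  product-∣-product d∣n zero = (λ _ → 1ℤ) , poly-const 1ℤ , λ x _ → sym (ℤₚ.*-identityʳ _)
  product-∣-product {d} d∣n (suc k) with suc k ∣? d | suc k ∣? n | product-∣-product d∣n k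
  ... | yes k∣d | no  k∤n | _ = contradiction (∣-trans k∣d d∣n) k∤n
  ... | no  k∤d | no  k∤n | rec rewrite product-reject k∤d | product-reject k∤n = rec
  ... | no  k∤d | yes k∣n | (q , q-poly , q≡) rewrite product-reject k∤d | product-accept k∣n =
        (λ x → ev (Φ (suc k)) x * q x) , poly-* (poly-ev (Φ (suc k))) q-poly , λ x b →
          trans (ev-⊗ (Φ (suc k)) (Π k) x) (trans (cong (ev (Φ (suc k)) x *_) (q≡ x b)) (lemma (ev (Φ (suc k)) x) (ev (cyclotomic-product d k) x) (q x)))
    where
    lemma : ∀ f d q → f * (d * q) ≡ d * (f * q)
    lemma = solve-∀
  ... | yes k∣d | yes k∣n | (q , q-poly , q≡) rewrite product-accept k∣d | product-accept k∣n =
        q , q-poly , λ x b →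
          trans (ev-⊗ (Φ (suc k)) (Π k) x) (trans (cong (ev (Φ (suc k)) x *_) (q≡ x b))
            (trans (sym (ℤₚ.*-assoc (ev (Φ (suc k)) x) _ _)) (cong (_* q x) (sym (ev-⊗ (Φ (suc k)) (cyclotomic-product d k) x)))))

  product-stable : ∀ {d} k → 0 < d → d ≤ k → cyclotomic-product d k ≡ cyclotomic-product d d
  product-stable {d} k 0<d d≤k with ℕₚ.m≤n⇒m<n∨m≡n d≤k
  ... | inj₂ refl = refl
  product-stable {d} (suc k) 0<d _ | inj₁ (s≤s d≤k) =
    trans (product-reject λ k∣d → ℕₚ.<⇒≱ (s≤s d≤k) (∣⇒≤ {{ℕ.>-nonZero 0<d}} k∣d)) (product-stable k 0<d d≤k)

  -- By induction x^d - 1 is the product of the Φ_e with e ∣ d. All of these occur in `Π m`, the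
  -- cofactor of Φ_n in x^n - 1.
  Φ-proper-∣ : ∀ {d} → d ∣ n → d < n → (λ x → ev (Φ n) x * (x ^ d - 1ℤ)) ∣ᶠ (λ x → x ^ n - 1ℤ)
  Φ-proper-∣ {zero}  0∣n _ = contradiction (0∣⇒≡0 0∣n) λ ()
  Φ-proper-∣ {suc d} d∣n (s≤s d<m) with product-∣-product d∣n m
  ... | q , q-poly , q≡ = q , q-poly , λ x b → begin
        x ^ n - 1ℤ                                              ≡⟨ Φ-product x b ⟨
        ev (Φ n ⊗ Π m) x                                        ≡⟨ ev-⊗ (Φ n) (Π m) x ⟩
        ev (Φ n) x * ev (Π m) x                                 ≡⟨ cong (ev (Φ n) x *_) (q≡ x b) ⟩
        ev (Φ n) x * (ev (cyclotomic-product (suc d) m) x * q x)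
          ≡⟨ cong (λ p → ev (Φ n) x * (ev p x * q x)) (product-stable m (s≤s z≤n) d<m) ⟩
        ev (Φ n) x * (ev (cyclotomic-product (suc d) (suc d)) x * q x)
          ≡⟨ cong (λ t → ev (Φ n) x * (t * q x)) (Factorisation.product (ih d<m) x b) ⟩
        ev (Φ n) x * ((x ^ suc d - 1ℤ) * q x)                   ≡⟨ ℤₚ.*-assoc (ev (Φ n) x) _ _ ⟨
        ev (Φ n) x * (x ^ suc d - 1ℤ) * q x                     ∎
    where open ≡-Reasoning

  factorisation-step : Factorisation m
  factorisation-step = record
    { cyclotomic = record
      { is-monic = monic-quotient (monic-X^-1 m) (proj₁ (product-∣ m ℕₚ.≤-refl)) λ x b →
          trans (ev-X^-1 n x) (trans (sym (Φ-product x b)) (trans (ev-⊗ (Φ n) (Π m) x) (ℤₚ.*-comm (ev (Φ n) x) _)))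
      ; ∣x^n-1 = ev (Π m) , poly-ev (Π m) , λ x b → trans (sym (Φ-product x b)) (ev-⊗ (Φ n) (Π m) x)
      ; proper-∣ = Φ-proper-∣
      }
    ; product = λ x b → trans (cong (λ p → ev p x) (product-accept {n} {m} ∣-refl)) (Φ-product x b)
    }

factorisation : ∀ m → Factorisation m
factorisation = <-rec Factorisation λ m ih → factorisation-step m ih

Φ-cyclotomic : ∀ {n} → 0 < n → Cyclotomic n (Φ n)
Φ-cyclotomic {suc m} _ = Factorisation.cyclotomic (factorisation m)

-- Finite sums

Σ< : ℕ → (ℕ → ℤ) → ℤ
Σ< zero    f = 0ℤ
Σ< (suc h) f = Σ< h f + f h

Σ<-cong : ∀ h {f g} → (∀ i → i < h → f i ≡ g i) → Σ< h f ≡ Σ< h g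
Σ<-cong zero    e = refl
Σ<-cong (suc h) e = cong₂ _+_ (Σ<-cong h λ i i<h → e i (ℕₚ.m<n⇒m<1+n i<h)) (e h (ℕₚ.n<1+n h))

Σ<-head : ∀ h f → Σ< (suc h) f ≡ f 0 + Σ< h (f ∘ suc)
Σ<-head zero    f = ℤₚ.+-comm 0ℤ (f 0)
Σ<-head (suc h) f = trans (cong (_+ f (suc h)) (Σ<-head h f)) (ℤₚ.+-assoc (f 0) _ _)

Σ<-linear : ∀ h a b f g → Σ< h (λ i → a * f i + b * g i) ≡ a * Σ< h f + b * Σ< h g
Σ<-linear zero    a b f g = sym (cong₂ _+_ (ℤₚ.*-zeroʳ a) (ℤₚ.*-zeroʳ b))
Σ<-linear (suc h) a b f g = trans (cong (_+ (a * f h + b * g h)) (Σ<-linear h a b f g))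
  (lemma a b (Σ< h f) (Σ< h g) (f h) (g h))
  where
  lemma : ∀ a b F G f g → a * F + b * G + (a * f + b * g) ≡ a * (F + f) + b * (G + g)
  lemma = solve-∀

Σ<-stable : ∀ N d f → (∀ j → N ≤ j → f j ≡ 0ℤ) → Σ< (d ℕ.+ N) f ≡ Σ< N f
Σ<-stable N zero    f z = refl
Σ<-stable N (suc d) f z = trans (cong₂ _+_ (Σ<-stable N d f z) (z (d ℕ.+ N) (ℕₚ.m≤n+m N d))) (ℤₚ.+-identityʳ _)

Σ<-cutoff : ∀ {N M} f → N ≤ M → (∀ j → N ≤ j → f j ≡ 0ℤ) → Σ< M f ≡ Σ< N f
Σ<-cutoff {N} {M} f N≤M z = trans (cong (λ m → Σ< m f) (sym (ℕₚ.m∸n+n≡m N≤M))) (Σ<-stable N (M ℕ.∸ N) f z)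

-- The alternating diagonal sums F n = Σ_j (-1)^j x^(j(j-1)/2) [n - j, j] collapse:
-- the two Pascal recurrences give F n + x^(n-2) F (n-3) = F (n-1) + x^(n-3) F (n-4).

-- The second Pascal rule [n-j+1, j+1] = [n-j, j+1] + x^(n-2j) [n-j, j], multiplied by x^(2j) to
-- avoid negative exponents when n < 2j. It is derived by induction from the first rule, which
-- defines `diag`.
diag-pascal : ∀ x n j →
  x ^ (j ℕ.+ j) * diag x (suc (suc n)) (suc j) ≡ x ^ n * diag x n j + x ^ (j ℕ.+ j) * diag x (suc n) (suc j)
diag-pascal x zero    zero = lemma x
  where
  lemma : ∀ x → 1ℤ * (1ℤ + x * 1ℤ * 0ℤ) ≡ 1ℤ * 1ℤ + 1ℤ * 0ℤ
  lemma = solve-∀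
diag-pascal x (suc n) zero = trans (cong (λ d → 1ℤ * (1ℤ + x * 1ℤ * d)) (trans (sym (ℤₚ.*-identityˡ _)) (diag-pascal x n zero)))
  (lemma (x ^ n) x (diag x (suc n) 1))
  where
  lemma : ∀ y x d → 1ℤ * (1ℤ + x * 1ℤ * (y * 1ℤ + 1ℤ * d)) ≡ x * y * 1ℤ + 1ℤ * (1ℤ + x * 1ℤ * d)
  lemma = solve-∀
diag-pascal x zero (suc j) = lemma (x ^ (suc j ℕ.+ suc j)) (x ^ suc (suc j))
  where
  lemma : ∀ y p → y * (0ℤ + p * 0ℤ) ≡ 1ℤ * 0ℤ + y * 0ℤ
  lemma = solve-∀
diag-pascal x (suc zero) (suc j) = lemma (x ^ (suc j ℕ.+ suc j)) (x ^ suc (suc j)) x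
  where
  lemma : ∀ y p x → y * (0ℤ + p * (0ℤ + p * 0ℤ)) ≡ x * 1ℤ * 0ℤ + y * (0ℤ + p * 0ℤ)
  lemma = solve-∀
diag-pascal x (suc (suc n)) (suc j) = begin
  y * (d₁ + p * d₂)
    ≡⟨ cong (λ z → z * (d₁ + p * d₂)) y≡ ⟩
  x * x * q * (d₁ + p * d₂)
    ≡⟨ lemma₁ x q d₁ p d₂ ⟩
  x * x * (q * d₁) + p * (x * x * q * d₂)
    ≡⟨ cong₂ (λ s t → x * x * s + p * t) (diag-pascal x n j)
         (trans (cong (_* d₂) (sym y≡)) (trans (diag-pascal x (suc n) (suc j)) (cong (λ z → x * x ^ n * c₂ + z * d₃) y≡))) ⟩
  x * x * (x ^ n * c₁ + q * c₂) + p * (x * x ^ n * c₂ + x * x * q * d₃)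
    ≡⟨ lemma₂ x (x ^ n) (x ^ j) q c₁ c₂ d₃ ⟩
  x * (x * x ^ n) * (c₁ + x * x ^ j * c₂) + x * x * q * (c₂ + p * d₃)
    ≡⟨ cong (λ z → x * (x * x ^ n) * (c₁ + x * x ^ j * c₂) + z * (c₂ + p * d₃)) (sym y≡) ⟩
  x * (x * x ^ n) * (c₁ + x * x ^ j * c₂) + y * (c₂ + p * d₃) ∎
  where
  open ≡-Reasoning
  y = x ^ (suc j ℕ.+ suc j)
  q = x ^ (j ℕ.+ j)
  p = x ^ suc (suc j)
  d₁ = diag x (suc (suc n)) (suc j)
  d₂ = diag x (suc (suc (suc n))) (suc (suc j))
  d₃ = diag x (suc (suc n)) (suc (suc j))
  c₁ = diag x n j
  c₂ = diag x (suc n) (suc j)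
  y≡ : y ≡ x * x * q
  y≡ = trans (cong (λ m → x * x ^ m) (ℕₚ.+-suc j j)) (sym (ℤₚ.*-assoc x x q))
  lemma₁ : ∀ x q d₁ p d₂ → x * x * q * (d₁ + p * d₂) ≡ x * x * (q * d₁) + p * (x * x * q * d₂)
  lemma₁ = solve-∀
  lemma₂ : ∀ x n j q c₁ c₂ d₃ →
    x * x * (n * c₁ + q * c₂) + x * (x * j) * (x * n * c₂ + x * x * q * d₃) ≡
    x * (x * n) * (c₁ + x * j * c₂) + x * x * q * (c₂ + x * (x * j) * d₃)
  lemma₂ = solve-∀

-- j (j - 1) / 2, the exponent in the q-Lucas sum.
tri : ℕ → ℕ
tri zero    = 0
tri (suc j) = tri j ℕ.+ j

weight : ℤ → ℕ → ℤ
weight x j = sgn j * x ^ tri j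

-- (-1)^j x^((j-1)(j-2)/2)
weight′ : ℤ → ℕ → ℤ
weight′ x zero    = x
weight′ x (suc j) = - weight x j

weight-suc : ∀ x j → weight x (suc j) ≡ - (weight x j * x ^ j)
weight-suc x j = trans (cong (λ t → - sgn j * t) (ℤₚ.^-distribˡ-+-* x (tri j) j)) (lemma (sgn j) (x ^ tri j) (x ^ j))
  where
  lemma : ∀ s t y → - s * (t * y) ≡ - (s * t * y)
  lemma = solve-∀

-- Because 1 + j(j+1)/2 = (j-1)(j-2)/2 + 2j. This absorbs the power x^(2j) of `diag-pascal` into a
-- change of weight; the factor x avoids the exponent -1 that would arise at j = 1 and j = 2.
weight-shift : ∀ x j → x * weight x (suc j) ≡ - (weight′ x j * x ^ (j ℕ.+ j))
weight-shift x zero    = lemma x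
  where
  lemma : ∀ x → x * (- 1ℤ * 1ℤ) ≡ - (x * 1ℤ)
  lemma = solve-∀
weight-shift x (suc j) = begin
  x * weight x (suc (suc j))                          ≡⟨ cong (x *_) (weight-suc x (suc j)) ⟩
  x * (- (weight x (suc j) * (x * x ^ j)))            ≡⟨ cong (λ t → x * (- (t * (x * x ^ j)))) (weight-suc x j) ⟩
  x * (- (- (weight x j * x ^ j) * (x * x ^ j)))      ≡⟨ lemma x (weight x j) (x ^ j) ⟩
  - (- weight x j * (x * (x * (x ^ j * x ^ j))))      ≡⟨ cong (λ t → - (- weight x j * (x * (x * t)))) (sym (ℤₚ.^-distribˡ-+-* x j j)) ⟩
  - (- weight x j * (x * (x * x ^ (j ℕ.+ j))))        ≡⟨ cong (λ m → - (- weight x j * (x * x ^ m))) (sym (ℕₚ.+-suc j j)) ⟩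
  - (weight′ x (suc j) * x ^ (suc j ℕ.+ suc j))       ∎
  where
  open ≡-Reasoning
  lemma : ∀ x w y → x * (- (- (w * y) * (x * y))) ≡ - (- w * (x * (x * (y * y))))
  lemma = solve-∀

-- The cut-off N is a separate argument because splitting off the head of a sum lowers it by one;
-- `F≡S` removes it afterwards.
F : ℤ → ℕ → ℕ → ℤ
F x N n = Σ< N (λ j → weight x j * diag x n j)

-- The companion sum produced by the second Pascal rule. The first rule expresses it through `F` and
-- so eliminates it again.
K : ℤ → ℕ → ℕ → ℤ
K x N n = Σ< N (λ j → weight′ x j * diag x n j)

F-recurrence : ∀ x N n → x * F x (suc N) (suc (suc n)) ≡ x * F x (suc N) (suc n) - x ^ n * K x N n
F-recurrence x N n = begin
  x * F x (suc N) (suc (suc n))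
    ≡⟨ cong (x *_) (Σ<-head N (λ j → weight x j * diag x (suc (suc n)) j)) ⟩
  x * (1ℤ + Σ< N A)
    ≡⟨ expand x (Σ< N A) ⟩
  -- The zero multiple makes the scaling of a single sum an instance of `Σ<-linear`.
  x + (x * Σ< N A + 0ℤ * Σ< N A)
    ≡⟨ cong (λ t → x + t) (sym (Σ<-linear N x 0ℤ A A)) ⟩
  x + Σ< N (λ j → x * A j + 0ℤ * A j)
    ≡⟨ cong (λ t → x + t) (Σ<-cong N λ j _ → term j) ⟩
  x + Σ< N (λ j → x * B j + (- (x ^ n)) * C j)
    ≡⟨ cong (λ t → x + t) (Σ<-linear N x (- (x ^ n)) B C) ⟩
  x + (x * Σ< N B + (- (x ^ n)) * Σ< N C)
    ≡⟨ collect x (Σ< N B) (x ^ n) (Σ< N C) ⟩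
  x * (1ℤ + Σ< N B) - x ^ n * Σ< N C
    ≡⟨ cong (λ t → x * t - x ^ n * Σ< N C) (sym (Σ<-head N (λ j → weight x j * diag x (suc n) j))) ⟩
  x * F x (suc N) (suc n) - x ^ n * K x N n ∎
  where
  open ≡-Reasoning
  A B C : ℕ → ℤ
  A j = weight x (suc j) * diag x (suc (suc n)) (suc j)
  B j = weight x (suc j) * diag x (suc n) (suc j)
  C j = weight′ x j * diag x n j
  expand : ∀ x s → x * (1ℤ + s) ≡ x + (x * s + 0ℤ * s)
  expand = solve-∀
  collect : ∀ x b p c → x + (x * b + (- p) * c) ≡ x * (1ℤ + b) - p * c
  collect = solve-∀
  regroup₁ : ∀ x w a → x * (w * a) + 0ℤ * (w * a) ≡ x * w * a
  regroup₁ = solve-∀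
  regroup₂ : ∀ v y a → - (v * y) * a ≡ - (v * (y * a))
  regroup₂ = solve-∀
  regroup₃ : ∀ v y p c b → - (v * (p * c + y * b)) ≡ - (v * y) * b + (- p) * (v * c)
  regroup₃ = solve-∀
  term : ∀ j → x * A j + 0ℤ * A j ≡ x * B j + (- (x ^ n)) * C j
  term j = begin
    x * A j + 0ℤ * A j
      ≡⟨ regroup₁ x (weight x (suc j)) (diag x (suc (suc n)) (suc j)) ⟩
    x * weight x (suc j) * diag x (suc (suc n)) (suc j)
      ≡⟨ cong (_* diag x (suc (suc n)) (suc j)) (weight-shift x j) ⟩
    - (weight′ x j * x ^ (j ℕ.+ j)) * diag x (suc (suc n)) (suc j)
      ≡⟨ regroup₂ (weight′ x j) (x ^ (j ℕ.+ j)) (diag x (suc (suc n)) (suc j)) ⟩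
    - (weight′ x j * (x ^ (j ℕ.+ j) * diag x (suc (suc n)) (suc j)))
      ≡⟨ cong (λ t → - (weight′ x j * t)) (diag-pascal x n j) ⟩
    - (weight′ x j * (x ^ n * diag x n j + x ^ (j ℕ.+ j) * diag x (suc n) (suc j)))
      ≡⟨ regroup₃ (weight′ x j) (x ^ (j ℕ.+ j)) (x ^ n) (diag x n j) (diag x (suc n) (suc j)) ⟩
    - (weight′ x j * x ^ (j ℕ.+ j)) * diag x (suc n) (suc j) + (- (x ^ n)) * C j
      ≡⟨ cong (λ t → t * diag x (suc n) (suc j) + (- (x ^ n)) * C j) (sym (weight-shift x j)) ⟩
    x * weight x (suc j) * diag x (suc n) (suc j) + (- (x ^ n)) * C j
      ≡⟨ cong (_+ (- (x ^ n)) * C j) (ℤₚ.*-assoc x _ _) ⟩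
    x * B j + (- (x ^ n)) * C j ∎

K-recurrence : ∀ x N n → K x (suc N) (suc (suc n)) ≡ x * F x (suc N) (suc n) - F x N n
K-recurrence x N n = begin
  K x (suc N) (suc (suc n))
    ≡⟨ Σ<-head N (λ j → weight′ x j * diag x (suc (suc n)) j) ⟩
  x * 1ℤ + Σ< N (λ j → - weight x j * diag x (suc (suc n)) (suc j))
    ≡⟨ cong (x * 1ℤ +_) (Σ<-cong N λ j _ → term j) ⟩
  x * 1ℤ + Σ< N (λ j → x * B j + (- 1ℤ) * C j)
    ≡⟨ cong (x * 1ℤ +_) (Σ<-linear N x (- 1ℤ) B C) ⟩
  x * 1ℤ + (x * Σ< N B + (- 1ℤ) * Σ< N C)
    ≡⟨ collect x (Σ< N B) (Σ< N C) ⟩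
  x * (1ℤ + Σ< N B) - Σ< N C
    ≡⟨ cong (λ t → x * t - Σ< N C) (sym (Σ<-head N (λ j → weight x j * diag x (suc n) j))) ⟩
  x * F x (suc N) (suc n) - F x N n ∎
  where
  open ≡-Reasoning
  B C : ℕ → ℤ
  B j = weight x (suc j) * diag x (suc n) (suc j)
  C j = weight x j * diag x n j
  collect : ∀ x b c → x * 1ℤ + (x * b + (- 1ℤ) * c) ≡ x * (1ℤ + b) - c
  collect = solve-∀
  regroup : ∀ x w y c b → - w * (c + x * y * b) ≡ x * (- (w * y) * b) + (- 1ℤ) * (w * c)
  regroup = solve-∀
  term : ∀ j → - weight x j * diag x (suc (suc n)) (suc j) ≡ x * B j + (- 1ℤ) * C j
  term j = trans (regroup x (weight x j) (x ^ j) (diag x n j) (diag x (suc n) (suc j)))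
    (cong (λ t → x * (t * diag x (suc n) (suc j)) + (- 1ℤ) * C j) (sym (weight-suc x j)))

n≤0+2*n : ∀ n → n ≤ 0 +2* n
n≤0+2*n zero    = z≤n
n≤0+2*n (suc n) = s≤s (ℕₚ.m≤n⇒m≤1+n (n≤0+2*n n))

S : ℤ → ℕ → ℤ
S x n = F x (suc n) n

F≡S : ∀ x {N n} → n < N → F x N n ≡ S x n
F≡S x {N} {n} n<N = Σ<-cutoff (λ j → weight x j * diag x n j) n<N λ j n<j →
  trans (cong (weight x j *_) (diag-vanishes x n j (ℕₚ.<-≤-trans n<j (n≤0+2*n j)))) (ℤₚ.*-zeroʳ (weight x j))

S-recurrence : ∀ {x} n → Big x → S x (4 ℕ.+ n) ≡ S x (3 ℕ.+ n) - x ^ suc n * (x * S x (suc n) - S x n)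
S-recurrence {x} n b = cancelˡ x≢0 (begin
  x * S x (4 ℕ.+ n)
    ≡⟨ F-recurrence x (4 ℕ.+ n) (suc (suc n)) ⟩
  x * F x (5 ℕ.+ n) (3 ℕ.+ n) - x * (x * x ^ n) * K x (4 ℕ.+ n) (suc (suc n))
    ≡⟨ cong (λ t → x * F x (5 ℕ.+ n) (3 ℕ.+ n) - x * (x * x ^ n) * t) (K-recurrence x (3 ℕ.+ n) n) ⟩
  x * F x (5 ℕ.+ n) (3 ℕ.+ n) - x * (x * x ^ n) * (x * F x (4 ℕ.+ n) (suc n) - F x (3 ℕ.+ n) n)
    ≡⟨ cong₂ (λ s t → x * s - x * (x * x ^ n) * t) (F≡S x {n = 3 ℕ.+ n} (ℕₚ.m≤n+m _ 1))
         (cong₂ (λ s t → x * s - t) (F≡S x {n = suc n} (ℕₚ.m≤n+m _ 2)) (F≡S x {n = n} (ℕₚ.m≤n+m _ 2))) ⟩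
  x * S x (3 ℕ.+ n) - x * (x * x ^ n) * (x * S x (suc n) - S x n)
    ≡⟨ lemma x (S x (3 ℕ.+ n)) (x * x ^ n) (x * S x (suc n) - S x n) ⟩
  x * (S x (3 ℕ.+ n) - x ^ suc n * (x * S x (suc n) - S x n)) ∎)
  where
  open ≡-Reasoning
  x≢0 : x ≢ 0ℤ
  x≢0 refl = contradiction b λ { (ℤ.+<+ ()) }
  lemma : ∀ x s p k → x * s - x * p * k ≡ x * (s - p * k)
  lemma = solve-∀

-- By `S-recurrence` the quantity S (n+3) + x^(n+1) S n does not change with n. At n = 0 it is zero,
-- since S 3 = 1 - (1 + x) = -x and S 0 = 1.
S-step : ∀ {x} n → Big x → S x (3 ℕ.+ n) ≡ - (x ^ suc n * S x n)
S-step {x} zero b = lemma x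
  where
  lemma : ∀ x → 0ℤ + 1ℤ * 1ℤ * 1ℤ + - 1ℤ * 1ℤ * (1ℤ + x * 1ℤ * (1ℤ + x * 1ℤ * 0ℤ))
      + - (- 1ℤ) * (x * 1ℤ) * (0ℤ + x * (x * 1ℤ) * (0ℤ + x * (x * 1ℤ) * 0ℤ)) + - (- (- 1ℤ)) * (x * (x * (x * 1ℤ))) * (0ℤ + x * (x * (x * 1ℤ)) * (0ℤ + x * (x * (x * 1ℤ)) * 0ℤ))
    ≡ - (x * 1ℤ * (0ℤ + 1ℤ * 1ℤ * 1ℤ))
  lemma = solve-∀
S-step {x} (suc n) b = trans (S-recurrence n b) (trans (cong (_- x ^ suc n * (x * S x (suc n) - S x n)) (S-step n b))
  (lemma x (x ^ suc n) (S x (suc n)) (S x n)))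
  where
  lemma : ∀ x y s t → - (y * t) - y * (x * s - t) ≡ - (x * y * s)
  lemma = solve-∀

-- Pentagonal exponents and the evaluation of θ_n

-- The generalised pentagonal number m (3 m - 1) / 2
pent : ℕ → ℕ
pent zero    = 0
pent (suc m) = pent m ℕ.+ suc (m ℕ.* 3)

pent-double : ∀ m → pent m ℕ.* 2 ℕ.+ m ≡ m ℕ.* (3 ℕ.* m)
pent-double zero    = refl
pent-double (suc m) = trans (lemma (pent m) m) (trans (cong (ℕ._+ (3 ℕ.+ m ℕ.* 6)) (pent-double m)) (lemma′ m))
  where
  lemma : ∀ p m → (p ℕ.+ suc (m ℕ.* 3)) ℕ.* 2 ℕ.+ suc m ≡ p ℕ.* 2 ℕ.+ m ℕ.+ (3 ℕ.+ m ℕ.* 6)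
  lemma = ℕ-Solver.solve-∀
  lemma′ : ∀ m → m ℕ.* (3 ℕ.* m) ℕ.+ (3 ℕ.+ m ℕ.* 6) ≡ suc m ℕ.* (3 ℕ.* suc m)
  lemma′ = ℕ-Solver.solve-∀

halve : ∀ {a} b → a ≡ b ℕ.* 2 → a / 2 ≡ b
halve b refl = m*n/n≡m b 2

θ-exponent₀ : ∀ m → (m ℕ.* (3 ℕ.* m ℕ.∸ 1)) / 2 ≡ pent m
θ-exponent₀ m = halve (pent m) (begin
  m ℕ.* (3 ℕ.* m ℕ.∸ 1)             ≡⟨ ℕₚ.*-distribˡ-∸ m (3 ℕ.* m) 1 ⟩
  m ℕ.* (3 ℕ.* m) ℕ.∸ m ℕ.* 1       ≡⟨ cong₂ ℕ._∸_ (sym (pent-double m)) (ℕₚ.*-identityʳ m) ⟩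
  pent m ℕ.* 2 ℕ.+ m ℕ.∸ m          ≡⟨ ℕₚ.m+n∸n≡m (pent m ℕ.* 2) m ⟩
  pent m ℕ.* 2                      ∎)
  where open ≡-Reasoning

θ-exponent₁ : ∀ m → (m ℕ.* (3 ℕ.* m ℕ.+ 1)) / 2 ≡ pent m ℕ.+ m
θ-exponent₁ m = halve (pent m ℕ.+ m)
  (trans (lemma m) (trans (cong (ℕ._+ m) (sym (pent-double m))) (lemma′ (pent m) m)))
  where
  lemma : ∀ m → m ℕ.* (3 ℕ.* m ℕ.+ 1) ≡ m ℕ.* (3 ℕ.* m) ℕ.+ m
  lemma = ℕ-Solver.solve-∀
  lemma′ : ∀ p m → p ℕ.* 2 ℕ.+ m ℕ.+ m ≡ (p ℕ.+ m) ℕ.* 2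
  lemma′ = ℕ-Solver.solve-∀

θ-exponent₂ : ∀ m → ((m ℕ.+ 1) ℕ.* (3 ℕ.* m ℕ.+ 2)) / 2 ≡ pent (suc m)
θ-exponent₂ m = halve (pent (suc m))
  (trans (lemma m) (trans (cong (ℕ._+ (2 ℕ.+ m ℕ.* 5)) (sym (pent-double m))) (lemma′ (pent m) m)))
  where
  lemma : ∀ m → (m ℕ.+ 1) ℕ.* (3 ℕ.* m ℕ.+ 2) ≡ m ℕ.* (3 ℕ.* m) ℕ.+ (2 ℕ.+ m ℕ.* 5)
  lemma = ℕ-Solver.solve-∀
  lemma′ : ∀ p m → p ℕ.* 2 ℕ.+ m ℕ.+ (2 ℕ.+ m ℕ.* 5) ≡ (p ℕ.+ suc (m ℕ.* 3)) ℕ.* 2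
  lemma′ = ℕ-Solver.solve-∀

S-0mod3 : ∀ {x} m → Big x → S x (m ℕ.* 3) ≡ sgn m * x ^ pent m
S-0mod3 zero    b = refl
S-0mod3 {x} (suc m) b = begin
  S x (3 ℕ.+ m ℕ.* 3)                               ≡⟨ S-step (m ℕ.* 3) b ⟩
  - (x ^ suc (m ℕ.* 3) * S x (m ℕ.* 3))             ≡⟨ cong (λ t → - (x ^ suc (m ℕ.* 3) * t)) (S-0mod3 m b) ⟩
  - (x ^ suc (m ℕ.* 3) * (sgn m * x ^ pent m))      ≡⟨ lemma (x ^ suc (m ℕ.* 3)) (sgn m) (x ^ pent m) ⟩
  - sgn m * (x ^ pent m * x ^ suc (m ℕ.* 3))        ≡⟨ cong (- sgn m *_) (sym (ℤₚ.^-distribˡ-+-* x (pent m) (suc (m ℕ.* 3)))) ⟩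
  sgn (suc m) * x ^ pent (suc m)                    ∎
  where
  open ≡-Reasoning
  lemma : ∀ a s p → - (a * (s * p)) ≡ - s * (p * a)
  lemma = solve-∀

S-1mod3 : ∀ {x} m → Big x → S x (suc (m ℕ.* 3)) ≡ sgn m * x ^ (pent m ℕ.+ m)
S-1mod3 zero    b = refl
S-1mod3 {x} (suc m) b = begin
  S x (3 ℕ.+ suc (m ℕ.* 3))                                    ≡⟨ S-step (suc (m ℕ.* 3)) b ⟩
  - (x ^ suc (suc (m ℕ.* 3)) * S x (suc (m ℕ.* 3)))            ≡⟨ cong (λ t → - (x ^ suc (suc (m ℕ.* 3)) * t)) (S-1mod3 m b) ⟩
  - (x ^ suc (suc (m ℕ.* 3)) * (sgn m * x ^ (pent m ℕ.+ m)))   ≡⟨ lemma (x ^ suc (suc (m ℕ.* 3))) (sgn m) (x ^ (pent m ℕ.+ m)) ⟩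
  - sgn m * (x ^ (pent m ℕ.+ m) * x ^ suc (suc (m ℕ.* 3)))     ≡⟨ cong (- sgn m *_) (sym (ℤₚ.^-distribˡ-+-* x (pent m ℕ.+ m) (suc (suc (m ℕ.* 3))))) ⟩
  - sgn m * x ^ (pent m ℕ.+ m ℕ.+ suc (suc (m ℕ.* 3)))         ≡⟨ cong (λ e → - sgn m * x ^ e) (exponent (pent m) m) ⟩
  sgn (suc m) * x ^ (pent (suc m) ℕ.+ suc m)                   ∎
  where
  open ≡-Reasoning
  lemma : ∀ a s p → - (a * (s * p)) ≡ - s * (p * a)
  lemma = solve-∀
  exponent : ∀ p m → p ℕ.+ m ℕ.+ suc (suc (m ℕ.* 3)) ≡ p ℕ.+ suc (m ℕ.* 3) ℕ.+ suc m
  exponent = ℕ-Solver.solve-∀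

S-2mod3 : ∀ {x} m → Big x → S x (suc (suc (m ℕ.* 3))) ≡ 0ℤ
S-2mod3 {x} zero b = lemma x
  where
  lemma : ∀ x → 0ℤ + 1ℤ * 1ℤ * 1ℤ + - 1ℤ * 1ℤ * (1ℤ + x * 1ℤ * 0ℤ) + - (- 1ℤ) * (x * 1ℤ) * (0ℤ + x * (x * 1ℤ) * 0ℤ) ≡ 0ℤ
  lemma = solve-∀
S-2mod3 {x} (suc m) b = trans (S-step (suc (suc (m ℕ.* 3))) b)
  (trans (cong (λ t → - (x ^ (3 ℕ.+ m ℕ.* 3) * t)) (S-2mod3 m b)) (cong -_ (ℤₚ.*-zeroʳ (x ^ (3 ℕ.+ m ℕ.* 3)))))

-- The value at 1 is F 1 - F (-1) with the convention F (-1) = 0, in agreement with θ_1 = 1.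
lucas : ℤ → ℕ → ℤ
lucas x zero          = 0ℤ
lucas x (suc zero)    = 1ℤ
lucas x (suc (suc n)) = S x (suc (suc n)) - x ^ suc n * S x n

-- `S` vanishes at indices 2 modulo 3. For n = 3m both summands of `lucas` survive and produce the
-- factor 1 + x^m; for n = 3m + 1 the second one vanishes, for n = 3m + 2 the first.
ev-θaux : ∀ {x} m r → Big x → r < 3 → 0 < r ℕ.+ m ℕ.* 3 → ev (θaux m r) x ≡ lucas x (r ℕ.+ m ℕ.* 3)
ev-θaux {x} (suc k) zero b _ _ = begin
  ev (θaux m 0) x
    ≡⟨ ev-scale (sgn m) ((const 1ℤ ⊕ X^ m) ⊗ X^ ((m ℕ.* (3 ℕ.* m ℕ.∸ 1)) / 2)) x ⟩
  sgn m * ev ((const 1ℤ ⊕ X^ m) ⊗ X^ ((m ℕ.* (3 ℕ.* m ℕ.∸ 1)) / 2)) x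
    ≡⟨ cong (sgn m *_) (trans (ev-⊗ (const 1ℤ ⊕ X^ m) (X^ ((m ℕ.* (3 ℕ.* m ℕ.∸ 1)) / 2)) x)
         (cong₂ _*_ (trans (ev-⊕ (const 1ℤ) (X^ m) x) (cong₂ _+_ (ev-const 1ℤ x) (ev-X^ m x)))
           (trans (ev-X^ ((m ℕ.* (3 ℕ.* m ℕ.∸ 1)) / 2) x) (cong (x ^_) (θ-exponent₀ m))))) ⟩
  sgn m * ((1ℤ + x ^ m) * x ^ pent m)
    ≡⟨ lemma (sgn k) (x ^ m) (x ^ pent m) ⟩
  sgn m * x ^ pent m - sgn k * (x ^ pent m * x ^ m)
    ≡⟨ cong (λ t → sgn m * x ^ pent m - sgn k * t) powers ⟩
  sgn m * x ^ pent m - sgn k * (x ^ (2 ℕ.+ k ℕ.* 3) * x ^ (pent k ℕ.+ k))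
    ≡⟨ lemma′ (sgn m * x ^ pent m) (sgn k) (x ^ (2 ℕ.+ k ℕ.* 3)) (x ^ (pent k ℕ.+ k)) ⟩
  sgn m * x ^ pent m - x ^ (2 ℕ.+ k ℕ.* 3) * (sgn k * x ^ (pent k ℕ.+ k))
    ≡⟨ cong₂ (λ s t → s - x ^ (2 ℕ.+ k ℕ.* 3) * t) (sym (S-0mod3 m b)) (sym (S-1mod3 k b)) ⟩
  lucas x (m ℕ.* 3) ∎
  where
  open ≡-Reasoning
  m = suc k
  lemma : ∀ s y p → - s * ((1ℤ + y) * p) ≡ - s * p - s * (p * y)
  lemma = solve-∀
  lemma′ : ∀ a s p q → a - s * (p * q) ≡ a - p * (s * q)
  lemma′ = solve-∀
  exponent : ∀ p k → p ℕ.+ suc (k ℕ.* 3) ℕ.+ suc k ≡ 2 ℕ.+ k ℕ.* 3 ℕ.+ (p ℕ.+ k)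
  exponent = ℕ-Solver.solve-∀
  powers : x ^ pent m * x ^ m ≡ x ^ (2 ℕ.+ k ℕ.* 3) * x ^ (pent k ℕ.+ k)
  powers = trans (sym (ℤₚ.^-distribˡ-+-* x (pent m) m))
    (trans (cong (x ^_) (exponent (pent k) k)) (ℤₚ.^-distribˡ-+-* x (2 ℕ.+ k ℕ.* 3) (pent k ℕ.+ k)))
ev-θaux {x} m (suc zero) b _ _ = trans (ev-scale (sgn m) (X^ ((m ℕ.* (3 ℕ.* m ℕ.+ 1)) / 2)) x)
  (trans (cong (sgn m *_) (trans (ev-X^ ((m ℕ.* (3 ℕ.* m ℕ.+ 1)) / 2) x) (cong (x ^_) (θ-exponent₁ m)))) (value m))
  where
  value : ∀ m → sgn m * x ^ (pent m ℕ.+ m) ≡ lucas x (suc (m ℕ.* 3))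
  value zero    = refl
  value (suc k) = trans (sym (S-1mod3 (suc k) b)) (sym (trans
    (cong (λ t → S x (4 ℕ.+ k ℕ.* 3) - x ^ (3 ℕ.+ k ℕ.* 3) * t) (S-2mod3 k b))
    (lemma (S x (4 ℕ.+ k ℕ.* 3)) (x ^ (3 ℕ.+ k ℕ.* 3)))))
    where
    lemma : ∀ s p → s - p * 0ℤ ≡ s
    lemma = solve-∀
ev-θaux {x} m (suc (suc zero)) b _ _ = begin
  ev (θaux m 2) x
    ≡⟨ ev-scale (- sgn m) (X^ (((m ℕ.+ 1) ℕ.* (3 ℕ.* m ℕ.+ 2)) / 2)) x ⟩
  - sgn m * ev (X^ (((m ℕ.+ 1) ℕ.* (3 ℕ.* m ℕ.+ 2)) / 2)) x
    ≡⟨ cong (- sgn m *_) (trans (ev-X^ (((m ℕ.+ 1) ℕ.* (3 ℕ.* m ℕ.+ 2)) / 2) x)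
         (trans (cong (x ^_) (θ-exponent₂ m)) (ℤₚ.^-distribˡ-+-* x (pent m) (suc (m ℕ.* 3))))) ⟩
  - sgn m * (x ^ pent m * x ^ suc (m ℕ.* 3))
    ≡⟨ lemma (sgn m) (x ^ pent m) (x ^ suc (m ℕ.* 3)) ⟩
  0ℤ - x ^ suc (m ℕ.* 3) * (sgn m * x ^ pent m)
    ≡⟨ cong₂ (λ s t → s - x ^ suc (m ℕ.* 3) * t) (sym (S-2mod3 m b)) (sym (S-0mod3 m b)) ⟩
  lucas x (2 ℕ.+ m ℕ.* 3) ∎
  where
  open ≡-Reasoning
  lemma : ∀ s p q → - s * (p * q) ≡ 0ℤ - q * (s * p)
  lemma = solve-∀
ev-θaux m (suc (suc (suc r))) b (s≤s (s≤s (s≤s ()))) _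

ev-θ : ∀ {x n} → Big x → 0 < n → ev (θ n) x ≡ lucas x n
ev-θ {x} {n} b 0<n = trans (ev-θaux (n / 3) (n % 3) b (m%n<n n 3) (subst (0 <_) n≡ 0<n)) (cong (lucas x) (sym n≡))
  where
  n≡ : n ≡ n % 3 ℕ.+ n / 3 ℕ.* 3
  n≡ = m≡m%n+[m/n]*n n 3

-- Term j + 1 of the q-Lucas sum for n + 2: term j + 1 of F (n+2) is paired with term j of F n. Term
-- 0 of F (n+2) stays unpaired and is the 1 in `lucas-sum`.
lucasTerm : ℤ → ℕ → ℕ → ℤ
lucasTerm x n j = weight x (suc j) * diag x (suc (suc n)) (suc j) - x ^ suc n * (weight x j * diag x n j)

n<0+2*half : ∀ n j → suc (suc n) / 2 ≤ j → n < 0 +2* j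
n<0+2*half n j h≤j = s≤s⁻¹ (s≤s⁻¹ (begin-strict
  suc (suc n)                                    ≡⟨ m≡m%n+[m/n]*n (suc (suc n)) 2 ⟩
  suc (suc n) % 2 ℕ.+ suc (suc n) / 2 ℕ.* 2      <⟨ ℕₚ.+-mono-<-≤ (m%n<n (suc (suc n)) 2) (ℕₚ.*-monoˡ-≤ 2 h≤j) ⟩
  2 ℕ.+ j ℕ.* 2                                  ≡⟨ cong (2 ℕ.+_) (trans (lemma j) (sym (+2*-correct 0 j))) ⟩
  suc (suc (0 +2* j))                            ∎))
  where
  open ℕₚ.≤-Reasoning
  lemma : ∀ j → j ℕ.* 2 ≡ j ℕ.+ j
  lemma = ℕ-Solver.solve-∀

-- The terms with 2 (j + 1) > n + 2 vanish, so the sum can stop where T_0' does.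
lucas-sum : ∀ x n → lucas x (suc (suc n)) ≡ 1ℤ + Σ< (suc (suc n) / 2) (lucasTerm x n)
lucas-sum x n = begin
  F x (3 ℕ.+ n) (2 ℕ.+ n) - x ^ suc n * S x n
    ≡⟨ cong₂ (λ s t → s - x ^ suc n * t) (Σ<-head N (λ j → weight x j * diag x (suc (suc n)) j)) (sym (F≡S x {N} (ℕₚ.m≤n+m _ 1))) ⟩
  1ℤ + Σ< N A - x ^ suc n * Σ< N C
    ≡⟨ lemma (Σ< N A) (x ^ suc n) (Σ< N C) ⟩
  1ℤ + (1ℤ * Σ< N A + (- (x ^ suc n)) * Σ< N C)
    ≡⟨ cong (1ℤ +_) (sym (Σ<-linear N 1ℤ (- (x ^ suc n)) A C)) ⟩
  1ℤ + Σ< N (λ j → 1ℤ * A j + (- (x ^ suc n)) * C j)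
    ≡⟨ cong (1ℤ +_) (Σ<-cong N λ j _ → lemma′ (A j) (x ^ suc n) (C j)) ⟩
  1ℤ + Σ< N (lucasTerm x n)
    ≡⟨ cong (1ℤ +_) (Σ<-cutoff (lucasTerm x n) h≤N vanishes) ⟩
  1ℤ + Σ< (suc (suc n) / 2) (lucasTerm x n) ∎
  where
  open ≡-Reasoning
  N = suc (suc n)
  A C : ℕ → ℤ
  A j = weight x (suc j) * diag x (suc (suc n)) (suc j)
  C j = weight x j * diag x n j
  lemma : ∀ a p c → 1ℤ + a - p * c ≡ 1ℤ + (1ℤ * a + (- p) * c)
  lemma = solve-∀
  lemma′ : ∀ a p c → 1ℤ * a + (- p) * c ≡ a - p * c
  lemma′ = solve-∀
  lemma″ : ∀ u p v → u * 0ℤ - p * (v * 0ℤ) ≡ 0ℤ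
  lemma″ = solve-∀
  h≤N : suc (suc n) / 2 ≤ N
  h≤N = m/n≤m (suc (suc n)) 2
  vanishes : ∀ j → suc (suc n) / 2 ≤ j → lucasTerm x n j ≡ 0ℤ
  vanishes j h≤j = trans (cong₂ (λ s t → weight x (suc j) * s - x ^ suc n * (weight x j * t))
      (diag-vanishes x (suc (suc n)) (suc j) (s≤s (s≤s (n<0+2*half n j h≤j)))) (diag-vanishes x n j (n<0+2*half n j h≤j)))
    (lemma″ (weight x (suc j)) (x ^ suc n) (weight x j))

-- With i = j + 1 and n = r + 2i this is the product form (1 - q^n)/(1 - q^(n-i)) [n-i, i] without
-- denominators. It follows from (R - 1) + R (J - 1) = R J - 1 and brings out the factor x^n - 1.
lucasTerm-fac : ∀ {x} r j → Big x →
  lucasTerm x (r +2* j) j * fac x (suc j) ≡ weight x (suc j) * (x ^ (r +2* suc j) - 1ℤ) * rise x r j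
lucasTerm-fac {x} r j b = cancelˡ (fac≢0 r b) (begin
  fac x r * ((w′ * d′ - x ^ suc n * (w * d)) * (fac x j * (J - 1ℤ)))
    ≡⟨ lemma₁ (fac x r) w′ d′ (x ^ suc n) w d (fac x j) (J - 1ℤ) ⟩
  w′ * (fac x r * (fac x j * (J - 1ℤ)) * d′) - x ^ suc n * w * (fac x r * fac x j * d) * (J - 1ℤ)
    ≡⟨ cong₂ (λ s t → w′ * s - t * (fac x r * fac x j * d) * (J - 1ℤ))
         (trans (diag-fac x r (suc j)) (cong (fac x) (ℕₚ.+-suc r j))) powers ⟩
  w′ * (fac x (r ℕ.+ j) * (R - 1ℤ)) - (- (R * w′)) * (fac x r * fac x j * d) * (J - 1ℤ)
    ≡⟨ cong (λ t → w′ * (fac x (r ℕ.+ j) * (R - 1ℤ)) - (- (R * w′)) * t * (J - 1ℤ)) (diag-fac x r j) ⟩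
  w′ * (fac x (r ℕ.+ j) * (R - 1ℤ)) - (- (R * w′)) * fac x (r ℕ.+ j) * (J - 1ℤ)
    ≡⟨ lemma₂ w′ (fac x (r ℕ.+ j)) R J ⟩
  fac x (r ℕ.+ j) * (w′ * (R * J - 1ℤ))
    ≡⟨ cong₂ (λ s t → s * (w′ * (t - 1ℤ))) (sym (fac-rise x r j))
         (trans (sym (ℤₚ.^-distribˡ-+-* x (suc (r ℕ.+ j)) (suc j))) (cong (x ^_) (sym index))) ⟩
  fac x r * rise x r j * (w′ * (x ^ (r +2* suc j) - 1ℤ))
    ≡⟨ lemma₃ (fac x r) (rise x r j) w′ (x ^ (r +2* suc j) - 1ℤ) ⟩
  fac x r * (w′ * (x ^ (r +2* suc j) - 1ℤ) * rise x r j) ∎)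
  where
  open ≡-Reasoning
  n = r +2* j
  J = x ^ suc j
  R = x ^ suc (r ℕ.+ j)
  w = weight x j
  w′ = weight x (suc j)
  d = diag x n j
  d′ = diag x (suc (suc n)) (suc j)
  lemma₁ : ∀ f w′ d′ p w d g J → f * ((w′ * d′ - p * (w * d)) * (g * J)) ≡ w′ * (f * (g * J) * d′) - p * w * (f * g * d) * J
  lemma₁ = solve-∀
  lemma₂ : ∀ w f R J → w * (f * (R - 1ℤ)) - (- (R * w)) * f * (J - 1ℤ) ≡ f * (w * (R * J - 1ℤ))
  lemma₂ = solve-∀
  lemma₃ : ∀ f r w p → f * r * (w * p) ≡ f * (w * p * r)
  lemma₃ = solve-∀
  lemma₄ : ∀ R y w → R * y * w ≡ - (R * (- (w * y)))
  lemma₄ = solve-∀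
  index : r +2* suc j ≡ suc (r ℕ.+ j) ℕ.+ suc j
  index = trans (cong (suc ∘ suc) (+2*-correct r j)) (sym (cong suc (ℕₚ.+-suc (r ℕ.+ j) j)))
  powers : x ^ suc n * w ≡ - (R * w′)
  powers = begin
    x ^ suc n * w                 ≡⟨ cong (λ m → x ^ suc m * w) (+2*-correct r j) ⟩
    x ^ (suc (r ℕ.+ j) ℕ.+ j) * w ≡⟨ cong (_* w) (ℤₚ.^-distribˡ-+-* x (suc (r ℕ.+ j)) j) ⟩
    R * x ^ j * w                 ≡⟨ lemma₄ R (x ^ j) w ⟩
    - (R * (- (w * x ^ j)))       ≡⟨ cong (λ t → - (R * t)) (sym (weight-suc x j)) ⟩
    - (R * w′)                    ∎

-- Congruences modulo x^n - 1

square-^ : ∀ x m → (x * x) ^ m ≡ x ^ (m ℕ.+ m)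
square-^ x zero    = refl
square-^ x (suc m) = trans (cong (x * x *_) (square-^ x m))
  (trans (ℤₚ.*-assoc x x _) (cong (λ k → x * x ^ k) (sym (ℕₚ.+-suc m m))))

record _≡_[mod_] (f g h : ℤ → ℤ) : Set where
  constructor congruent
  field
    k      : ℤ → ℤ
    k-poly : IsPoly k
    eq     : f ≐ (λ x → g x + h x * k x)

mod-* : ∀ {f g f′ g′ h} → IsPoly g → IsPoly g′ → IsPoly h → f ≡ g [mod h ] → f′ ≡ g′ [mod h ] →
  (λ x → f x * f′ x) ≡ (λ x → g x * g′ x) [mod h ]
mod-* {f} {g} {f′} {g′} {h} pg pg′ ph (congruent k k-poly e) (congruent k′ k′-poly e′) = congruent
  (λ x → g x * k′ x + k x * g′ x + h x * k x * k′ x)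
  (poly-+ (poly-+ (poly-* pg k′-poly) (poly-* k-poly pg′)) (poly-* (poly-* ph k-poly) k′-poly))
  λ x b → trans (cong₂ _*_ (e x b) (e′ x b)) (lemma (g x) (g′ x) (h x) (k x) (k′ x))
  where
  lemma : ∀ g g′ h k k′ → (g + h * k) * (g′ + h * k′) ≡ g * g′ + h * (g * k′ + k * g′ + h * k * k′)
  lemma = solve-∀

mod-≐ : ∀ {f g f′ g′ h} → f ≐ f′ → g ≐ g′ → f ≡ g [mod h ] → f′ ≡ g′ [mod h ]
mod-≐ {h = h} e e′ (congruent k k-poly eq) = congruent k k-poly
  λ x b → trans (sym (e x b)) (trans (eq x b) (cong (_+ h x * k x) (e′ x b)))

-- Exponents are read modulo n, where p ≡ -i and q ≡ -2 i - e.
factor-congruence : ∀ n b c′ p q i e → p ℕ.+ i ≡ suc c′ ℕ.* n → q ℕ.+ i ℕ.+ (e ℕ.+ i) ≡ n →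
  (λ x → ((x * x) ^ p - 1ℤ) * (x ^ (b ℕ.* n ℕ.+ b ℕ.* n ℕ.+ (e ℕ.+ i) ℕ.+ i) - 1ℤ)) ≡
  (λ x → x ^ e * ((x ^ q - 1ℤ) * ((x * x) ^ (b ℕ.* n ℕ.+ i) - 1ℤ))) [mod (λ x → x ^ n - 1ℤ) ]
factor-congruence n b c′ p q i e p+i≡ n≡
  with x^d-1∣x^ed-1 n (c′ ℕ.+ c′ ℕ.+ 2 ℕ.+ (b ℕ.+ b)) | x^d-1∣x^ed-1 n (suc (c′ ℕ.+ c′)) | x^d-1∣x^ed-1 n (suc (b ℕ.+ b))
... | k₁ , k₁-poly , k₁≡ | k₂ , k₂-poly , k₂≡ | k₃ , k₃-poly , k₃≡ = congruent
  (λ x → x ^ e * k₁ x - x ^ (e ℕ.+ q) * k₂ x - k₃ x)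
  (poly-sub (poly-sub (poly-* (poly-^ e) k₁-poly) (poly-* (poly-^ (e ℕ.+ q)) k₂-poly)) k₃-poly)
  λ x big → begin
    ((x * x) ^ p - 1ℤ) * (x ^ m - 1ℤ)
      ≡⟨ lemma₁ ((x * x) ^ p) (x ^ m) ⟩
    (x * x) ^ p * x ^ m - (x * x) ^ p - x ^ m + 1ℤ
      ≡⟨ cong₂ (λ s t → s - t - x ^ m + 1ℤ) (pm≡ x) (p≡ x) ⟩
    x ^ e * x ^ (α ℕ.* n) - x ^ (e ℕ.+ q) * x ^ (β ℕ.* n) - x ^ m + 1ℤ
      ≡⟨ lemma₂ (x ^ e) (x ^ (α ℕ.* n)) (x ^ (e ℕ.+ q)) (x ^ (β ℕ.* n)) (x ^ m) (x ^ (γ ℕ.* n)) ⟩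
    x ^ (γ ℕ.* n) - x ^ (e ℕ.+ q) - x ^ m + x ^ e + (x ^ e * (x ^ (α ℕ.* n) - 1ℤ) - x ^ (e ℕ.+ q) * (x ^ (β ℕ.* n) - 1ℤ) - (x ^ (γ ℕ.* n) - 1ℤ))
      ≡⟨ cong₂ _+_ (sym (right x)) (trans (cong₂ (λ s t → x ^ e * s - t - (x ^ (γ ℕ.* n) - 1ℤ)) (k₁≡ x big) (cong (x ^ (e ℕ.+ q) *_) (k₂≡ x big)))
           (cong (λ t → x ^ e * ((x ^ n - 1ℤ) * k₁ x) - x ^ (e ℕ.+ q) * ((x ^ n - 1ℤ) * k₂ x) - t) (k₃≡ x big))) ⟩
    R x + (x ^ e * ((x ^ n - 1ℤ) * k₁ x) - x ^ (e ℕ.+ q) * ((x ^ n - 1ℤ) * k₂ x) - (x ^ n - 1ℤ) * k₃ x)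
      ≡⟨ lemma₃ (R x) (x ^ e) (x ^ n - 1ℤ) (k₁ x) (x ^ (e ℕ.+ q)) (k₂ x) (k₃ x) ⟩
    R x + (x ^ n - 1ℤ) * (x ^ e * k₁ x - x ^ (e ℕ.+ q) * k₂ x - k₃ x) ∎
  where
  open ≡-Reasoning
  m = b ℕ.* n ℕ.+ b ℕ.* n ℕ.+ (e ℕ.+ i) ℕ.+ i
  -- The multiples of n dropped in reducing exponents: 2p + m = e + α n, 2p = e + q + β n, and e + q
  -- + 2 (b n + i) = γ n.
  α = c′ ℕ.+ c′ ℕ.+ 2 ℕ.+ (b ℕ.+ b)
  β = suc (c′ ℕ.+ c′)
  γ = suc (b ℕ.+ b)
  R : ℤ → ℤ
  R x = x ^ e * ((x ^ q - 1ℤ) * ((x * x) ^ (b ℕ.* n ℕ.+ i) - 1ℤ))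
  lemma₁ : ∀ s t → (s - 1ℤ) * (t - 1ℤ) ≡ s * t - s - t + 1ℤ
  lemma₁ = solve-∀
  lemma₂ : ∀ e a q b m g → e * a - q * b - m + 1ℤ ≡ g - q - m + e + (e * (a - 1ℤ) - q * (b - 1ℤ) - (g - 1ℤ))
  lemma₂ = solve-∀
  lemma₃ : ∀ r e w k₁ q k₂ k₃ → r + (e * (w * k₁) - q * (w * k₂) - w * k₃) ≡ r + w * (e * k₁ - q * k₂ - k₃)
  lemma₃ = solve-∀
  lemma₄ : ∀ e q z → e * ((q - 1ℤ) * (z - 1ℤ)) ≡ e * q * z - e * q - e * z + e
  lemma₄ = solve-∀
  2p+2i≡ : p ℕ.+ p ℕ.+ (i ℕ.+ i) ≡ suc c′ ℕ.* n ℕ.+ suc c′ ℕ.* n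
  2p+2i≡ = trans (ℕ+-interchange p i) (cong₂ ℕ._+_ p+i≡ p+i≡)
    where
    ℕ+-interchange : ∀ p i → p ℕ.+ p ℕ.+ (i ℕ.+ i) ≡ (p ℕ.+ i) ℕ.+ (p ℕ.+ i)
    ℕ+-interchange = ℕ-Solver.solve-∀
  pm-index : p ℕ.+ p ℕ.+ m ≡ e ℕ.+ α ℕ.* n
  pm-index = trans (shuffle p i e (b ℕ.* n)) (trans (cong (ℕ._+ (e ℕ.+ (b ℕ.* n ℕ.+ b ℕ.* n))) 2p+2i≡) (collect c′ n e b))
    where
    shuffle : ∀ p i e t → p ℕ.+ p ℕ.+ (t ℕ.+ t ℕ.+ (e ℕ.+ i) ℕ.+ i) ≡ p ℕ.+ p ℕ.+ (i ℕ.+ i) ℕ.+ (e ℕ.+ (t ℕ.+ t))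
    shuffle = ℕ-Solver.solve-∀
    collect : ∀ c n e b → suc c ℕ.* n ℕ.+ suc c ℕ.* n ℕ.+ (e ℕ.+ (b ℕ.* n ℕ.+ b ℕ.* n)) ≡ e ℕ.+ (c ℕ.+ c ℕ.+ 2 ℕ.+ (b ℕ.+ b)) ℕ.* n
    collect = ℕ-Solver.solve-∀
  p-index : p ℕ.+ p ≡ e ℕ.+ q ℕ.+ β ℕ.* n
  p-index = ℕₚ.+-cancelʳ-≡ (i ℕ.+ i) _ _ (trans 2p+2i≡ (trans (expand c′ n) (trans (cong (ℕ._+ suc (c′ ℕ.+ c′) ℕ.* n) (sym n≡)) (shuffle q i e (β ℕ.* n)))))
    where
    expand : ∀ c n → suc c ℕ.* n ℕ.+ suc c ℕ.* n ≡ n ℕ.+ suc (c ℕ.+ c) ℕ.* n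
    expand = ℕ-Solver.solve-∀
    shuffle : ∀ q i e t → q ℕ.+ i ℕ.+ (e ℕ.+ i) ℕ.+ t ≡ e ℕ.+ q ℕ.+ t ℕ.+ (i ℕ.+ i)
    shuffle = ℕ-Solver.solve-∀
  eqz-index : e ℕ.+ q ℕ.+ (b ℕ.* n ℕ.+ i ℕ.+ (b ℕ.* n ℕ.+ i)) ≡ γ ℕ.* n
  eqz-index = trans (shuffle e q (b ℕ.* n) i) (trans (cong (ℕ._+ (b ℕ.* n ℕ.+ b ℕ.* n)) n≡) (collect b n))
    where
    shuffle : ∀ e q t i → e ℕ.+ q ℕ.+ (t ℕ.+ i ℕ.+ (t ℕ.+ i)) ≡ q ℕ.+ i ℕ.+ (e ℕ.+ i) ℕ.+ (t ℕ.+ t)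
    shuffle = ℕ-Solver.solve-∀
    collect : ∀ b n → n ℕ.+ (b ℕ.* n ℕ.+ b ℕ.* n) ≡ suc (b ℕ.+ b) ℕ.* n
    collect = ℕ-Solver.solve-∀
  ez-index : e ℕ.+ (b ℕ.* n ℕ.+ i ℕ.+ (b ℕ.* n ℕ.+ i)) ≡ m
  ez-index = shuffle e (b ℕ.* n) i
    where
    shuffle : ∀ e t i → e ℕ.+ (t ℕ.+ i ℕ.+ (t ℕ.+ i)) ≡ t ℕ.+ t ℕ.+ (e ℕ.+ i) ℕ.+ i
    shuffle = ℕ-Solver.solve-∀
  p≡ : ∀ x → (x * x) ^ p ≡ x ^ (e ℕ.+ q) * x ^ (β ℕ.* n)
  p≡ x = trans (square-^ x p) (trans (cong (x ^_) p-index) (ℤₚ.^-distribˡ-+-* x (e ℕ.+ q) (β ℕ.* n)))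
  pm≡ : ∀ x → (x * x) ^ p * x ^ m ≡ x ^ e * x ^ (α ℕ.* n)
  pm≡ x = trans (cong (_* x ^ m) (square-^ x p)) (trans (sym (ℤₚ.^-distribˡ-+-* x (p ℕ.+ p) m))
    (trans (cong (x ^_) pm-index) (ℤₚ.^-distribˡ-+-* x e (α ℕ.* n))))
  right : ∀ x → R x ≡ x ^ (γ ℕ.* n) - x ^ (e ℕ.+ q) - x ^ m + x ^ e
  right x = begin
    R x
      ≡⟨ lemma₄ (x ^ e) (x ^ q) Z ⟩
    x ^ e * x ^ q * Z - x ^ e * x ^ q - x ^ e * Z + x ^ e
      ≡⟨ cong₂ (λ s t → s * t - s - x ^ e * t + x ^ e) (sym (ℤₚ.^-distribˡ-+-* x e q)) (square-^ x z) ⟩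
    x ^ (e ℕ.+ q) * x ^ (z ℕ.+ z) - x ^ (e ℕ.+ q) - x ^ e * x ^ (z ℕ.+ z) + x ^ e
      ≡⟨ cong₂ (λ s t → s - x ^ (e ℕ.+ q) - t + x ^ e)
           (trans (sym (ℤₚ.^-distribˡ-+-* x (e ℕ.+ q) (z ℕ.+ z))) (cong (x ^_) eqz-index))
           (trans (sym (ℤₚ.^-distribˡ-+-* x e (z ℕ.+ z))) (cong (x ^_) ez-index)) ⟩
    x ^ (γ ℕ.* n) - x ^ (e ℕ.+ q) - x ^ m + x ^ e ∎
    where
    z = b ℕ.* n ℕ.+ i
    Z = (x * x) ^ z

rise-head : ∀ x m j → rise x m (suc j) ≡ (x ^ suc m - 1ℤ) * rise x (suc m) j
rise-head x m zero    = trans (ℤₚ.*-identityˡ _) (trans (cong (λ k → x ^ k - 1ℤ) (ℕₚ.+-comm m 1)) (sym (ℤₚ.*-identityʳ _)))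
rise-head x m (suc j) = trans (cong₂ (λ r k → r * (x ^ k - 1ℤ)) (rise-head x m j) (ℕₚ.+-suc m (suc j)))
  (ℤₚ.*-assoc (x ^ suc m - 1ℤ) _ _)

-- The factors are paired in opposite orders, the first of `rise (x * x) u` with the last of the
-- other product, so that each pair falls under `factor-congruence`. The parameter s, 0 in the
-- application, grows by one per pair; the pairs contribute x^(s+1), ..., x^(s+t), and for s = 0
-- these multiply to the power of x in the Lucas term.
rise-congruence : ∀ n b c′ t s u v → u ℕ.+ suc t ≡ suc c′ ℕ.* n → v ℕ.+ suc t ℕ.+ (s ℕ.+ suc t) ≡ n →
  (λ x → rise (x * x) u t * rise x (b ℕ.* n ℕ.+ b ℕ.* n ℕ.+ (s ℕ.+ suc t)) t) ≡
  (λ x → x ^ (s ℕ.* t ℕ.+ tri (suc t)) * (rise x v t * rise (x * x) (b ℕ.* n) t)) [mod (λ x → x ^ n - 1ℤ) ]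
rise-congruence n b c′ zero s u v _ _ = congruent (λ _ → 0ℤ) (poly-const 0ℤ)
  λ x _ → trans (lemma (x ^ n)) (cong (λ m → x ^ (m ℕ.+ 0) * (1ℤ * 1ℤ) + (x ^ n - 1ℤ) * 0ℤ) (sym (ℕₚ.*-zeroʳ s)))
  where
  lemma : ∀ y → 1ℤ * 1ℤ ≡ 1ℤ * (1ℤ * 1ℤ) + (y - 1ℤ) * 0ℤ
  lemma = solve-∀
rise-congruence n b c′ (suc t) s u v u≡ v≡ = mod-≐
  (λ x _ → trans (lemma₁ ((x * x) ^ suc u - 1ℤ) (x ^ (base ℕ.+ suc t) - 1ℤ) (rise (x * x) (suc u) t) (rise x base t))
    (cong (_* (rise x base t * (x ^ (base ℕ.+ suc t) - 1ℤ))) (sym (rise-head (x * x) u t))))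
  (λ x _ → trans (lemma₂ (x ^ suc s) (x ^ suc v - 1ℤ) ((x * x) ^ (b ℕ.* n ℕ.+ suc t) - 1ℤ)
      (x ^ (suc s ℕ.* t ℕ.+ tri (suc t))) (rise x (suc v) t) (rise (x * x) (b ℕ.* n) t))
    (cong₂ (λ p r → p * (r * (rise (x * x) (b ℕ.* n) t * ((x * x) ^ (b ℕ.* n ℕ.+ suc t) - 1ℤ))))
      (trans (sym (ℤₚ.^-distribˡ-+-* x (suc s) (suc s ℕ.* t ℕ.+ tri (suc t)))) (cong (x ^_) (exponent s t (tri (suc t)))))
      (sym (rise-head x v t))))
  (mod-*
    (poly-* (poly-^ (suc s)) (poly-* (poly-^-1 (suc v)) (poly-² (poly-^-1 (b ℕ.* n ℕ.+ suc t)))))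
    (poly-* (poly-^ (suc s ℕ.* t ℕ.+ tri (suc t))) (poly-* (poly-rise (suc v) t) (poly-² (poly-rise (b ℕ.* n) t))))
    (poly-^-1 n)
    (subst (λ j → (λ x → ((x * x) ^ suc u - 1ℤ) * (x ^ (b ℕ.* n ℕ.+ b ℕ.* n ℕ.+ j ℕ.+ suc t) - 1ℤ)) ≡
        (λ x → x ^ suc s * ((x ^ suc v - 1ℤ) * ((x * x) ^ (b ℕ.* n ℕ.+ suc t) - 1ℤ))) [mod (λ x → x ^ n - 1ℤ) ])
      (sym (ℕₚ.+-suc s (suc t)))
      (factor-congruence n b c′ (suc u) (suc v) (suc t) (suc s) u≡′ v≡′))
    (subst (λ j → (λ x → rise (x * x) (suc u) t * rise x (b ℕ.* n ℕ.+ b ℕ.* n ℕ.+ j) t) ≡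
        (λ x → x ^ (suc s ℕ.* t ℕ.+ tri (suc t)) * (rise x (suc v) t * rise (x * x) (b ℕ.* n) t)) [mod (λ x → x ^ n - 1ℤ) ])
      (sym (ℕₚ.+-suc s (suc t)))
      (rise-congruence n b c′ t (suc s) (suc u) (suc v) u≡′ v≡′)))
  where
  base = b ℕ.* n ℕ.+ b ℕ.* n ℕ.+ (s ℕ.+ suc (suc t))
  u≡′ : suc u ℕ.+ suc t ≡ suc c′ ℕ.* n
  u≡′ = trans (sym (ℕₚ.+-suc u (suc t))) u≡
  v≡′ : suc v ℕ.+ suc t ℕ.+ (suc s ℕ.+ suc t) ≡ n
  v≡′ = trans (cong₂ ℕ._+_ (sym (ℕₚ.+-suc v (suc t))) (sym (ℕₚ.+-suc s (suc t)))) v≡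
  lemma₁ : ∀ p q r s → p * q * (r * s) ≡ p * r * (s * q)
  lemma₁ = solve-∀
  lemma₂ : ∀ s v z p r w → s * (v * z) * (p * (r * w)) ≡ s * p * (v * r * (w * z))
  lemma₂ = solve-∀
  exponent : ∀ s t T → suc s ℕ.+ (suc s ℕ.* t ℕ.+ T) ≡ s ℕ.* suc t ℕ.+ (T ℕ.+ suc t)
  exponent = ℕ-Solver.solve-∀

-- Functions divisible by m after localisation at the polynomials coprime to m

record Negligible (m f : ℤ → ℤ) : Set where
  constructor negligible
  field
    {q p}  : ℤ → ℤ
    q-poly : IsPoly q
    p-poly : IsPoly p
    q∤m    : Coprime q m
    eq     : (λ x → q x * f x) ≐ (λ x → m x * p x)

negligible-0 : ∀ {m} → Negligible m (λ _ → 0ℤ)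
negligible-0 {m} = negligible (poly-const 1ℤ) (poly-const 0ℤ) coprime-1 λ x _ → sym (ℤₚ.*-zeroʳ (m x))

negligible-+ : ∀ {m f g} → IsPoly m → Negligible m f → Negligible m g → Negligible m (λ x → f x + g x)
negligible-+ {m} {f} {g} pm (negligible {q} {p} pq pp cop e) (negligible {q′} {p′} pq′ pp′ cop′ e′) =
  negligible (poly-* pq pq′) (poly-+ (poly-* pq′ pp) (poly-* pq pp′)) (coprime-* pq pq′ pm cop cop′) λ x b →
    trans (lemma₁ (q x) (q′ x) (f x) (g x)) (trans (cong₂ (λ s t → q′ x * s + q x * t) (e x b) (e′ x b))
      (lemma₂ (q x) (q′ x) (m x) (p x) (p′ x)))
  where
  lemma₁ : ∀ q q′ f g → q * q′ * (f + g) ≡ q′ * (q * f) + q * (q′ * g)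
  lemma₁ = solve-∀
  lemma₂ : ∀ q q′ m p p′ → q′ * (m * p) + q * (m * p′) ≡ m * (q′ * p + q * p′)
  lemma₂ = solve-∀

negligible-scale : ∀ {m f} c → Negligible m f → Negligible m (λ x → c * f x)
negligible-scale {m} {f} c (negligible {q} {p} pq pp cop e) =
  negligible pq (poly-* (poly-const c) pp) cop λ x b →
    trans (lemma (q x) c (f x)) (trans (cong (c *_) (e x b)) (lemma (c) (m x) (p x)))
  where
  lemma : ∀ q c f → q * (c * f) ≡ c * (q * f)
  lemma = solve-∀

negligible-≐ : ∀ {m f g} → f ≐ g → Negligible m f → Negligible m g
negligible-≐ h (negligible {q} pq pp cop e) = negligible pq pp cop λ x b → trans (cong (q x *_) (sym (h x b))) (e x b)

negligible-modulus : ∀ {m m′ f} → m ≐ m′ → Negligible m f → Negligible m′ f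
negligible-modulus h (negligible {p = p} pq pp cop e) =
  negligible pq pp (coprime-sym (coprime-≐ h (coprime-sym cop))) λ x b → trans (e x b) (cong (_* p x) (h x b))

negligible-Σ< : ∀ {m} h (f : ℕ → ℤ → ℤ) → IsPoly m → (∀ i → i < h → Negligible m (f i)) → Negligible m (λ x → Σ< h (λ i → f i x))
negligible-Σ< zero    f pm n = negligible-0
negligible-Σ< (suc h) f pm n =
  negligible-+ pm (negligible-Σ< h f pm λ i i<h → n i (ℕₚ.m<n⇒m<1+n i<h)) (n h (ℕₚ.n<1+n h))

congMod : ∀ A B M → Negligible (ev M) (λ x → ev A x - ev B x) → CongMod A B M
congMod A B M (negligible {q} {p} (Q , Q≡) (P , P≡) (coprime {u} {v} (U , U≡) (V , V≡) c c≢0 bezout) e) =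
  P , Q ,
  (U , V , c , c≢0 , ≐⇒≈P (U ⊗ Q ⊕ V ⊗ M) (const c) λ x b →
    trans (ev-⊕ (U ⊗ Q) (V ⊗ M) x) (trans (cong₂ _+_
        (trans (ev-⊗ U Q x) (cong₂ _*_ (U≡ x b) (Q≡ x b)))
        (trans (ev-⊗ V M x) (cong (_* ev M x) (V≡ x b))))
      (trans (bezout x b) (sym (ev-const c x))))) ,
  ≐⇒≈P (Q ⊗ (A ⊖ B)) (M ⊗ P) λ x b →
    trans (ev-⊗ Q (A ⊖ B) x) (trans (cong₂ _*_ (Q≡ x b) (ev-⊖ A B x))
      (trans (e x b) (trans (cong (ev M x *_) (sym (P≡ x b))) (sym (ev-⊗ M P x)))))

-- Denominators and the individual summand

fac-coprime : ∀ {n D} j → IsPoly D → (∀ {i} → ¬ n ∣ i → Coprime (λ x → x ^ i - 1ℤ) D) → j < n → Coprime (λ x → fac x j) D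
fac-coprime zero    pD h j<n = coprime-1
fac-coprime (suc j) pD h j<n = coprime-* (poly-fac j) (poly-^-1 (suc j)) pD
  (fac-coprime j pD h (ℕₚ.<-trans (ℕₚ.n<1+n j) j<n))
  (h λ n∣j → ℕₚ.<⇒≱ j<n (∣⇒≤ n∣j))

-- Here n ∤ 2 (b n + i) because 0 < 2i < n. The strict bound matters: for even n the factor with i =
-- n/2 is divisible by x^n - 1.
rise-coprime : ∀ {n D} b j → IsPoly D → (∀ {i} → ¬ n ∣ i → Coprime (λ x → x ^ i - 1ℤ) D) → j ℕ.+ j < n →
  Coprime (λ x → rise (x * x) (b ℕ.* n) j) D
rise-coprime b zero    pD h _ = coprime-1
rise-coprime {n} b (suc j) pD h 2j<n = coprime-* (poly-² (poly-rise (b ℕ.* n) j)) (poly-² (poly-^-1 (b ℕ.* n ℕ.+ suc j))) pD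
  (rise-coprime b j pD h (ℕₚ.≤-<-trans (ℕₚ.+-mono-≤ (ℕₚ.n≤1+n j) (ℕₚ.n≤1+n j)) 2j<n))
  (coprime-≐ (λ x _ → cong (_- 1ℤ) (sym (square-^ x (b ℕ.* n ℕ.+ suc j))))
    (h λ n∣i → ℕₚ.<⇒≱ 2j<n (∣⇒≤ (∣m+n∣m⇒∣n (subst (n ∣_) (index b n (suc j)) n∣i) (divides (b ℕ.+ b) refl)))))
  where
  index : ∀ b n j → b ℕ.* n ℕ.+ j ℕ.+ (b ℕ.* n ℕ.+ j) ≡ (b ℕ.+ b) ℕ.* n ℕ.+ (j ℕ.+ j)
  index = ℕ-Solver.solve-∀

-- Both sides are `fac x (t + j + u)` divided by `fac x t * fac x u`. For j = 0 this is the symmetry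
-- of the binomial coefficients.
qbinom-rise : ∀ t j u {x} → Big x →
  ev (qbinom (t ℕ.+ j ℕ.+ u) u) x * rise x t j ≡ ev (qbinom (t ℕ.+ j ℕ.+ u) t) x * rise x u j
qbinom-rise t j u {x} b = cancelˡ (*-≢0 (fac≢0 t b) (fac≢0 u b)) (begin
  fac x t * fac x u * (q₁ * rise x t j)   ≡⟨ lemma₁ (fac x t) (fac x u) q₁ (rise x t j) ⟩
  fac x t * rise x t j * fac x u * q₁     ≡⟨ cong (λ f → f * fac x u * q₁) (fac-rise x t j) ⟩
  fac x (t ℕ.+ j) * fac x u * q₁          ≡⟨ qbinom-fac (t ℕ.+ j) u b ⟩
  fac x (t ℕ.+ j ℕ.+ u)                   ≡⟨ cong (fac x) index ⟩
  fac x (u ℕ.+ j ℕ.+ t)                   ≡⟨ qbinom-fac (u ℕ.+ j) t b ⟨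
  fac x (u ℕ.+ j) * fac x t * ev (qbinom (u ℕ.+ j ℕ.+ t) t) x
    ≡⟨ cong₂ (λ f m → f * fac x t * ev (qbinom m t) x) (sym (fac-rise x u j)) (sym index) ⟩
  fac x u * rise x u j * fac x t * q₀     ≡⟨ lemma₂ (fac x t) (fac x u) q₀ (rise x u j) ⟩
  fac x t * fac x u * (q₀ * rise x u j)   ∎)
  where
  open ≡-Reasoning
  q₁ = ev (qbinom (t ℕ.+ j ℕ.+ u) u) x
  q₀ = ev (qbinom (t ℕ.+ j ℕ.+ u) t) x
  lemma₁ : ∀ f g q r → f * g * (q * r) ≡ f * r * g * q
  lemma₁ = solve-∀
  lemma₂ : ∀ f g q r → g * r * f * q ≡ f * g * (q * r)
  lemma₂ = solve-∀
  index : t ℕ.+ j ℕ.+ u ≡ u ℕ.+ j ℕ.+ t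
  index = trans (ℕₚ.+-comm (t ℕ.+ j) u) (trans (cong (u ℕ.+_) (ℕₚ.+-comm t j)) (sym (ℕₚ.+-assoc u j t)))

fac-qbinom : ∀ k j {x} → Big x → fac x j * ev (qbinom (k ℕ.+ j) j) x ≡ rise x k j
fac-qbinom k j {x} b = cancelˡ (fac≢0 k b)
  (trans (sym (ℤₚ.*-assoc (fac x k) _ _)) (trans (qbinom-fac k j b) (sym (fac-rise x k j))))

-- Relative to [an, bn] the first binomial carries x^(2(a-b)n) - 1 = W (E + W k₂), where W = x^n - 1
-- and E = 2 (a - b). The other factors therefore matter only modulo W, where they match the Lucas
-- term. The difference acquires the factor W^2, a multiple of D^2.
summand-negligible : ∀ {D} b c′ r j u n N L → IsPoly D → D ∣ᶠ (λ x → x ^ n - 1ℤ) →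
  (∀ {i} → ¬ n ∣ i → Coprime (λ x → x ^ i - 1ℤ) D) →
  n ≡ r +2* suc j → u ℕ.+ suc j ≡ suc c′ ℕ.* n →
  N ≡ b ℕ.* n ℕ.+ suc j ℕ.+ u → L ≡ b ℕ.* n ℕ.+ b ℕ.* n ℕ.+ suc j ℕ.+ suc j →
  Negligible (λ x → D x * D x) (λ x →
    sgn (suc j) * (ev (qbinom N u) (x * x) * ev (qbinom L (suc j)) x) -
    ℤ.+ (2 ℕ.* suc c′) * (ev (qbinom N (b ℕ.* n)) (x * x) * lucasTerm x (n ℕ.∸ 2) j))
summand-negligible {D} b c′ r j u n N L pD (g , g-poly , W≡) cop refl u≡ refl refl
  with rise-congruence n b c′ j 0 u r u≡ v≡ | power-expansion n (2 ℕ.* suc c′)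
  where
  v≡ : r ℕ.+ suc j ℕ.+ suc j ≡ n
  v≡ = sym (+2*-correct r (suc j))
... | congruent k₁ k₁-poly BC≡ | k₂ , k₂-poly , Y≡ = negligible
  -- This multiplier clears the denominators of both binomials except for Z = x^(2bn+2j+2) - 1,
  -- which may share a factor with D; `algebra` trades Z against the numerator of the second
  -- binomial.
  (poly-* (poly-fac (suc j)) (poly-² (poly-rise bn j)))
  (poly-* (poly-* g-poly g-poly)
    (poly-* (poly-* (poly-const s) (poly-² (poly-ev (qbinom N bn))))
      (poly-+ (poly-* (poly-* (poly-^ (tri (suc j))) (poly-* (poly-rise r j) (poly-² (poly-rise bn j)))) k₂-poly)
        (poly-* k₁-poly (poly-+ (poly-const E) (poly-* (poly-^-1 n) k₂-poly))))))
  (coprime-sym (coprime-* pD pD (poly-* (poly-fac (suc j)) (poly-² (poly-rise bn j))) cop-D cop-D))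
  λ x big → trans
    (algebra (fac x (suc j)) (rise (x * x) bn j) s (ev (qbinom N u) (x * x)) (ev (qbinom L (suc j)) x) E
      (ev (qbinom N bn) (x * x)) (lucasTerm x (n ℕ.∸ 2) j) ((x * x) ^ (bn ℕ.+ suc j) - 1ℤ) (rise (x * x) u j)
      (rise x (bn ℕ.+ bn ℕ.+ suc j) j) (x ^ n - 1ℤ) (k₁ x) (k₂ x) (x ^ tri (suc j)) (rise x r j)
      (trans (qbinom-rise bn (suc j) u (big-* big big))
        (cong (λ t → ev (qbinom N bn) (x * x) * (rise (x * x) u j * t))
          (trans (cong (_- 1ℤ) (trans (square-^ x (u ℕ.+ suc j)) (cong (x ^_) Y-index))) (Y≡ x))))
      (trans (fac-qbinom (bn ℕ.+ bn ℕ.+ suc j) (suc j) big)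
        (cong (λ t → rise x (bn ℕ.+ bn ℕ.+ suc j) j * (t - 1ℤ))
          (trans (cong (x ^_) Z-index) (sym (square-^ x (bn ℕ.+ suc j))))))
      (lucasTerm-fac r j big)
      (BC≡ x big))
    (trans (cong (λ w → w * w * P x) (W≡ x big)) (regroup (D x) (g x) (P x)))
  where
  open ≡-Reasoning
  bn = b ℕ.* n
  s = sgn (suc j)
  E = ℤ.+ (2 ℕ.* suc c′)
  P : ℤ → ℤ
  P x = s * ev (qbinom N bn) (x * x) *
    (x ^ tri (suc j) * (rise x r j * rise (x * x) bn j) * k₂ x + k₁ x * (E + (x ^ n - 1ℤ) * k₂ x))
  n≡ : n ≡ suc (suc (r ℕ.+ j ℕ.+ j))
  n≡ = cong (suc ∘ suc) (+2*-correct r j)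
  2j<n : j ℕ.+ j < n
  2j<n = subst (j ℕ.+ j <_) (sym n≡) (s≤s (ℕₚ.m≤n⇒m≤1+n (ℕₚ.+-monoˡ-≤ j (ℕₚ.m≤n+m j r))))
  j<n : suc j < n
  j<n = subst (suc j <_) (sym n≡) (s≤s (s≤s (ℕₚ.m≤n+m j (r ℕ.+ j))))
  cop-D : Coprime D (λ x → fac x (suc j) * rise (x * x) bn j)
  cop-D = coprime-sym (coprime-* (poly-fac (suc j)) (poly-² (poly-rise bn j)) pD
    (fac-coprime (suc j) pD cop j<n) (rise-coprime b j pD cop 2j<n))
  Y-index : u ℕ.+ suc j ℕ.+ (u ℕ.+ suc j) ≡ 2 ℕ.* suc c′ ℕ.* n
  Y-index = trans (cong₂ ℕ._+_ u≡ u≡) (double (suc c′) n)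
    where
    double : ∀ c n → c ℕ.* n ℕ.+ c ℕ.* n ≡ 2 ℕ.* c ℕ.* n
    double = ℕ-Solver.solve-∀
  Z-index : bn ℕ.+ bn ℕ.+ suc j ℕ.+ suc j ≡ bn ℕ.+ suc j ℕ.+ (bn ℕ.+ suc j)
  Z-index = shuffle bn (suc j)
    where
    shuffle : ∀ m j → m ℕ.+ m ℕ.+ j ℕ.+ j ≡ m ℕ.+ j ℕ.+ (m ℕ.+ j)
    shuffle = ℕ-Solver.solve-∀
  regroup : ∀ d g p → d * g * (d * g) * p ≡ d * d * (g * g * p)
  regroup = solve-∀
  algebra : ∀ f A s q₁ q₂ E q₀ ℓ Z B C W k₁ k₂ T R →
    q₁ * (A * Z) ≡ q₀ * (B * (W * (E + W * k₂))) → f * q₂ ≡ C * Z →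
    ℓ * f ≡ s * T * W * R → B * C ≡ T * (R * A) + W * k₁ →
    f * A * (s * (q₁ * q₂) - E * (q₀ * ℓ)) ≡ W * W * (s * q₀ * (T * (R * A) * k₂ + k₁ * (E + W * k₂)))
  algebra f A s q₁ q₂ E q₀ ℓ Z B C W k₁ k₂ T R e₁ e₂ e₃ e₄ = begin
    f * A * (s * (q₁ * q₂) - E * (q₀ * ℓ))
      ≡⟨ step₁ f A s q₁ q₂ E q₀ ℓ ⟩
    s * A * q₁ * (f * q₂) - E * q₀ * A * (ℓ * f)
      ≡⟨ cong₂ (λ t v → s * A * q₁ * t - E * q₀ * A * v) e₂ e₃ ⟩
    s * A * q₁ * (C * Z) - E * q₀ * A * (s * T * W * R)
      ≡⟨ step₂ A s q₁ C Z (E * q₀ * A * (s * T * W * R)) ⟩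
    s * C * (q₁ * (A * Z)) - E * q₀ * A * (s * T * W * R)
      ≡⟨ cong (λ t → s * C * t - E * q₀ * A * (s * T * W * R)) e₁ ⟩
    s * C * (q₀ * (B * (W * (E + W * k₂)))) - E * q₀ * A * (s * T * W * R)
      ≡⟨ step₃ s C q₀ B (W * (E + W * k₂)) (E * q₀ * A * (s * T * W * R)) ⟩
    s * q₀ * (B * C) * (W * (E + W * k₂)) - E * q₀ * A * (s * T * W * R)
      ≡⟨ cong (λ t → s * q₀ * t * (W * (E + W * k₂)) - E * q₀ * A * (s * T * W * R)) e₄ ⟩
    s * q₀ * (T * (R * A) + W * k₁) * (W * (E + W * k₂)) - E * q₀ * A * (s * T * W * R)
      ≡⟨ step₄ A s E q₀ W k₁ k₂ T R ⟩
    W * W * (s * q₀ * (T * (R * A) * k₂ + k₁ * (E + W * k₂))) ∎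
    where
    step₁ : ∀ f A s q₁ q₂ E q₀ ℓ → f * A * (s * (q₁ * q₂) - E * (q₀ * ℓ)) ≡ s * A * q₁ * (f * q₂) - E * q₀ * A * (ℓ * f)
    step₁ = solve-∀
    step₂ : ∀ A s q C Z t → s * A * q * (C * Z) - t ≡ s * C * (q * (A * Z)) - t
    step₂ = solve-∀
    step₃ : ∀ s C q B Y t → s * C * (q * (B * Y)) - t ≡ s * q * (B * C) * Y - t
    step₃ = solve-∀
    step₄ : ∀ A s E q W k₁ k₂ T R →
      s * q * (T * (R * A) + W * k₁) * (W * (E + W * k₂)) - E * q * A * (s * T * W * R) ≡
      W * W * (s * q * (T * (R * A) * k₂ + k₁ * (E + W * k₂)))
    step₄ = solve-∀

-- Expansion of both sides and comparison term by term

ev-sumP-applyUpTo : ∀ (g : ℕ → Poly) h x → ev (sumP (applyUpTo g h)) x ≡ Σ< h (λ i → ev (g (h ℕ.∸ suc i)) x)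
ev-sumP-applyUpTo g zero    x = refl
ev-sumP-applyUpTo g (suc h) x = begin
  ev (g 0 ⊕ sumP (applyUpTo (g ∘ suc) h)) x
    ≡⟨ ev-⊕ (g 0) (sumP (applyUpTo (g ∘ suc) h)) x ⟩
  ev (g 0) x + ev (sumP (applyUpTo (g ∘ suc) h)) x
    ≡⟨ cong (ev (g 0) x +_) (ev-sumP-applyUpTo (g ∘ suc) h x) ⟩
  ev (g 0) x + Σ< h (λ i → ev (g (suc (h ℕ.∸ suc i))) x)
    ≡⟨ ℤₚ.+-comm (ev (g 0) x) _ ⟩
  Σ< h (λ i → ev (g (suc (h ℕ.∸ suc i))) x) + ev (g 0) x
    ≡⟨ cong₂ _+_ (Σ<-cong h λ i i<h → cong (λ k → ev (g k) x) (sym (ℕₚ.+-∸-assoc 1 i<h)))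
         (cong (λ k → ev (g k) x) (sym (ℕₚ.n∸n≡0 h))) ⟩
  Σ< (suc h) (λ i → ev (g (suc h ℕ.∸ suc i)) x) ∎
  where open ≡-Reasoning

-- The order is reversed: j measures the distance from the upper end, so that j = 0 becomes the main
-- term.
ev-sumP-range : ∀ (f : ℕ → Poly) U h x → h ≤ U →
  ev (sumP (map f (rangeℕ (U ℕ.∸ h) U))) x ≡ Σ< (suc h) (λ j → ev (f (U ℕ.∸ j)) x)
ev-sumP-range f U h x h≤U = trans (cong (λ l → ev (sumP l) x) list≡)
  (trans (ev-sumP-applyUpTo (λ i → f (U ℕ.∸ h ℕ.+ i)) (suc h) x) (Σ<-cong (suc h) λ j j<1+h →
    cong (λ k → ev (f k) x) (trans (sym (ℕₚ.+-∸-assoc (U ℕ.∸ h) (s≤s⁻¹ j<1+h))) (cong (ℕ._∸ j) (ℕₚ.m∸n+n≡m h≤U)))))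
  where
  list≡ : map f (rangeℕ (U ℕ.∸ h) U) ≡ applyUpTo (λ i → f (U ℕ.∸ h ℕ.+ i)) (suc h)
  list≡ = trans (cong (λ m → map f (map ((U ℕ.∸ h) ℕ.+_) (upTo (suc m)))) (ℕₚ.m∸[m∸n]≡n h≤U))
    (trans (cong (map f) (Listₚ.map-applyUpTo id ((U ℕ.∸ h) ℕ.+_) (suc h)))
      (Listₚ.map-applyUpTo ((U ℕ.∸ h) ℕ.+_) f (suc h)))

sgn-+ : ∀ m n → sgn (m ℕ.+ n) ≡ sgn m * sgn n
sgn-+ zero    n = sym (ℤₚ.*-identityˡ _)
sgn-+ (suc m) n = trans (cong -_ (sgn-+ m n)) (ℤₚ.neg-distribˡ-* (sgn m) (sgn n))

sgn² : ∀ n → sgn n * sgn n ≡ 1ℤ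
sgn² zero    = refl
sgn² (suc n) = trans (lemma (sgn n)) (sgn² n)
  where
  lemma : ∀ s → - s * - s ≡ s * s
  lemma = solve-∀

ev-θ-sum : ∀ {x n} → Big x → 0 < n → ev (θ n) x ≡ 1ℤ + Σ< (n / 2) (lucasTerm x (n ℕ.∸ 2))
ev-θ-sum {x} {suc zero}    b 0<n = ev-θ b 0<n
ev-θ-sum {x} {suc (suc n)} b 0<n = trans (ev-θ b 0<n) (lucas-sum x n)

-- Writing a as b + (c′ + 1) builds in a > b and turns the truncated differences of the statement
-- into sums.
module _ (b c′ n : ℕ) (0<n : 0 < n) where

  private
    a h U N : ℕ
    a = b ℕ.+ suc c′
    h = n / 2
    U = suc c′ ℕ.* n
    N = a ℕ.* n

    L : ℕ → ℕ
    L j = 2 ℕ.* N ℕ.∸ 2 ℕ.* (U ℕ.∸ j)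

    E : ℤ
    E = ℤ.+ (2 ℕ.* suc c′)

    Q₀ : ℤ → ℤ
    Q₀ x = ev (qbinom N (b ℕ.* n)) (x * x)

    summand : ℕ → ℤ → ℤ
    summand j x = ev (qbinom N (U ℕ.∸ j)) (x * x) * ev (qbinom (L j) j) x

    -- Term j + 1 against its share of the right side, both without the common sign `sgn U`.
    δ : ℕ → ℤ → ℤ
    δ j x = sgn (suc j) * summand (suc j) x - E * (Q₀ x * lucasTerm x (n ℕ.∸ 2) j)

    U≡ : N ℕ.∸ b ℕ.* n ≡ U
    U≡ = trans (cong (ℕ._∸ b ℕ.* n) (ℕₚ.*-distribʳ-+ n b (suc c′))) (ℕₚ.m+n∸m≡n (b ℕ.* n) U)

    h≤U : h ≤ U
    h≤U = ℕₚ.≤-trans (m/n≤m n 2) (ℕₚ.m≤m+n n (c′ ℕ.* n))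

    N≡ : ∀ {j} → j ≤ U → N ≡ b ℕ.* n ℕ.+ j ℕ.+ (U ℕ.∸ j)
    N≡ {j} j≤U = trans (ℕₚ.*-distribʳ-+ n b (suc c′))
      (trans (cong (b ℕ.* n ℕ.+_) (sym (ℕₚ.m+[n∸m]≡n j≤U))) (sym (ℕₚ.+-assoc (b ℕ.* n) j _)))

    L≡ : ∀ {j} → j ≤ U → L j ≡ b ℕ.* n ℕ.+ b ℕ.* n ℕ.+ j ℕ.+ j
    L≡ {j} j≤U = trans (cong (λ m → 2 ℕ.* m ℕ.∸ 2 ℕ.* (U ℕ.∸ j)) (N≡ j≤U))
      (trans (cong (ℕ._∸ 2 ℕ.* (U ℕ.∸ j)) (shuffle (b ℕ.* n) j (U ℕ.∸ j))) (ℕₚ.m+n∸n≡m _ (2 ℕ.* (U ℕ.∸ j))))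
      where
      shuffle : ∀ t j u → 2 ℕ.* (t ℕ.+ j ℕ.+ u) ≡ t ℕ.+ t ℕ.+ j ℕ.+ j ℕ.+ 2 ℕ.* u
      shuffle = ℕ-Solver.solve-∀

  ev-T0' : ∀ x → ev (T0' a b n) x ≡ Σ< (suc h) (λ j → sgn (U ℕ.∸ j) * summand j x)
  ev-T0' x rewrite U≡ = trans
    (ev-sumP-range (λ k → scale (sgn k) (qbinom² N k ⊗ qbinom (2 ℕ.* N ℕ.∸ 2 ℕ.* k) (U ℕ.∸ k))) U h x h≤U)
     (Σ<-cong (suc h) λ j j<1+h → begin
    ev (scale (sgn (U ℕ.∸ j)) (qbinom² N (U ℕ.∸ j) ⊗ qbinom (L j) (U ℕ.∸ (U ℕ.∸ j)))) x
      ≡⟨ ev-scale (sgn (U ℕ.∸ j)) (qbinom² N (U ℕ.∸ j) ⊗ qbinom (L j) (U ℕ.∸ (U ℕ.∸ j))) x ⟩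
    sgn (U ℕ.∸ j) * ev (qbinom² N (U ℕ.∸ j) ⊗ qbinom (L j) (U ℕ.∸ (U ℕ.∸ j))) x
      ≡⟨ cong (sgn (U ℕ.∸ j) *_) (ev-⊗ (qbinom² N (U ℕ.∸ j)) (qbinom (L j) (U ℕ.∸ (U ℕ.∸ j))) x) ⟩
    sgn (U ℕ.∸ j) * (ev (qbinom² N (U ℕ.∸ j)) x * ev (qbinom (L j) (U ℕ.∸ (U ℕ.∸ j))) x)
      ≡⟨ cong₂ (λ s m → sgn (U ℕ.∸ j) * (s * ev (qbinom (L j) m) x)) (ev-spread (qbinom N (U ℕ.∸ j)) x)
           (ℕₚ.m∸[m∸n]≡n (ℕₚ.≤-trans (s≤s⁻¹ j<1+h) h≤U)) ⟩
    sgn (U ℕ.∸ j) * summand j x ∎)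
    where open ≡-Reasoning

  ev-RHS : ∀ {x} → Big x →
    ev (RHS a b n) x ≡ sgn U * (Q₀ x * (1ℤ + E * Σ< h (lucasTerm x (n ℕ.∸ 2))))
  ev-RHS {x} big rewrite U≡ | ℕₚ.m+n∸m≡n b (suc c′) = begin
    ev (scale (sgn U) (q ⊗ (const 1ℤ ⊖ scale E (const 1ℤ ⊖ θ n)))) x
      ≡⟨ ev-scale (sgn U) (q ⊗ (const 1ℤ ⊖ scale E (const 1ℤ ⊖ θ n))) x ⟩
    sgn U * ev (q ⊗ (const 1ℤ ⊖ scale E (const 1ℤ ⊖ θ n))) x
      ≡⟨ cong (sgn U *_) (trans (ev-⊗ q (const 1ℤ ⊖ scale E (const 1ℤ ⊖ θ n)) x)
           (cong₂ _*_ (ev-spread (qbinom N (b ℕ.* n)) x)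
             (trans (ev-⊖ (const 1ℤ) (scale E (const 1ℤ ⊖ θ n)) x)
               (cong₂ _-_ (ev-const 1ℤ x) (trans (ev-scale E (const 1ℤ ⊖ θ n) x)
                 (cong (E *_) (trans (ev-⊖ (const 1ℤ) (θ n) x) (cong₂ _-_ (ev-const 1ℤ x) (ev-θ-sum big 0<n))))))))) ⟩
    -- The constant term of θ_n cancels the 1 in 1 - θ_n. What remains without the factor E is
    -- matched by the term j = 0 of T_0'.
    sgn U * (Q₀ x * (1ℤ - E * (1ℤ - (1ℤ + Σ< h (lucasTerm x (n ℕ.∸ 2))))))
      ≡⟨ lemma (sgn U) (Q₀ x) E (Σ< h (lucasTerm x (n ℕ.∸ 2))) ⟩
    sgn U * (Q₀ x * (1ℤ + E * Σ< h (lucasTerm x (n ℕ.∸ 2)))) ∎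
    where
    open ≡-Reasoning
    q = qbinom² N (b ℕ.* n)
    lemma : ∀ s q e t → s * (q * (1ℤ - e * (1ℤ - (1ℤ + t)))) ≡ s * (q * (1ℤ + e * t))
    lemma = solve-∀

  summand-0 : ∀ {x} → Big x → summand 0 x ≡ Q₀ x
  summand-0 {x} big = trans (cong₂ _*_ first second) (ℤₚ.*-identityʳ _)
    where
    first : ev (qbinom N U) (x * x) ≡ Q₀ x
    first = trans (sym (ℤₚ.*-identityʳ _)) (trans
      (subst (λ m → ev (qbinom m U) (x * x) * 1ℤ ≡ ev (qbinom m (b ℕ.* n)) (x * x) * 1ℤ) (sym (N≡ z≤n))
        (qbinom-rise (b ℕ.* n) 0 U (big-* big big)))
      (ℤₚ.*-identityʳ _))
    second : ev (qbinom (L 0) 0) x ≡ 1ℤ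
    second = trans (sym (ℤₚ.*-identityˡ _))
      (trans (cong (λ m → 1ℤ * ev (qbinom m 0) x) (sym (ℕₚ.+-identityʳ (L 0)))) (fac-qbinom (L 0) 0 big))

  difference : (λ x → Σ< h (λ j → sgn U * δ j x)) ≐ (λ x → ev (T0' a b n) x - ev (RHS a b n) x)
  difference x big = sym (begin
    ev (T0' a b n) x - ev (RHS a b n) x
      ≡⟨ cong₂ _-_ (trans (ev-T0' x) (Σ<-head h (λ j → sgn (U ℕ.∸ j) * summand j x))) (ev-RHS big) ⟩
    sgn U * summand 0 x + Σ< h (λ j → sgn (U ℕ.∸ suc j) * summand (suc j) x) - sgn U * (Q₀ x * (1ℤ + E * Σ< h ℓ))
      ≡⟨ cong₂ (λ s t → sgn U * s + t - sgn U * (Q₀ x * (1ℤ + E * Σ< h ℓ))) (summand-0 big) (Σ<-cong h λ j j<h → signs j (ℕₚ.≤-trans j<h h≤U)) ⟩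
    sgn U * Q₀ x + Σ< h (λ j → sgn U * A j) - sgn U * (Q₀ x * (1ℤ + E * Σ< h ℓ))
      ≡⟨ cong (λ t → sgn U * Q₀ x + t - sgn U * (Q₀ x * (1ℤ + E * Σ< h ℓ))) (trans (Σ<-cong h λ j _ → pad (sgn U) (A j)) (Σ<-linear h (sgn U) 0ℤ A A)) ⟩
    sgn U * Q₀ x + (sgn U * Σ< h A + 0ℤ * Σ< h A) - sgn U * (Q₀ x * (1ℤ + E * Σ< h ℓ))
      ≡⟨ lemma (sgn U) (Q₀ x) (Σ< h A) E (Σ< h ℓ) ⟩
    sgn U * Σ< h A + (- (sgn U * E * Q₀ x)) * Σ< h ℓ
      ≡⟨ Σ<-linear h (sgn U) (- (sgn U * E * Q₀ x)) A ℓ ⟨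
    Σ< h (λ j → sgn U * A j + (- (sgn U * E * Q₀ x)) * ℓ j)
      ≡⟨ Σ<-cong h (λ j _ → lemma′ (sgn U) (A j) E (Q₀ x) (ℓ j)) ⟩
    Σ< h (λ j → sgn U * δ j x) ∎)
    where
    open ≡-Reasoning
    A ℓ : ℕ → ℤ
    A j = sgn (suc j) * summand (suc j) x
    ℓ = lucasTerm x (n ℕ.∸ 2)
    pad : ∀ s a → s * a ≡ s * a + 0ℤ * a
    pad = solve-∀
    lemma : ∀ s q a e t → s * q + (s * a + 0ℤ * a) - s * (q * (1ℤ + e * t)) ≡ s * a + (- (s * e * q)) * t
    lemma = solve-∀
    lemma′ : ∀ s a e q t → s * a + (- (s * e * q)) * t ≡ s * (a - e * (q * t))
    lemma′ = solve-∀
    signs : ∀ j → suc j ≤ U → sgn (U ℕ.∸ suc j) * summand (suc j) x ≡ sgn U * A j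
    signs j j<U = begin
      s * t                                            ≡⟨ cong (_* t) (sym (ℤₚ.*-identityʳ s)) ⟩
      s * 1ℤ * t                                       ≡⟨ cong (λ o → s * o * t) (sym (sgn² (suc j))) ⟩
      s * (sgn (suc j) * sgn (suc j)) * t              ≡⟨ assoc s (sgn (suc j)) t ⟩
      s * sgn (suc j) * (sgn (suc j) * t)              ≡⟨ cong (_* A j) (trans (sym (sgn-+ (U ℕ.∸ suc j) (suc j))) (cong sgn (ℕₚ.m∸n+n≡m j<U))) ⟩
      sgn U * A j                                      ∎
      where
      s = sgn (U ℕ.∸ suc j)
      t = summand (suc j) x
      assoc : ∀ s o t → s * (o * o) * t ≡ s * o * (o * t)
      assoc = solve-∀

  δ-negligible : ∀ j → j < h → Negligible (λ x → ev (Φ n) x * ev (Φ n) x) (δ j)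
  δ-negligible j j<h = summand-negligible b c′ (n ℕ.∸ (suc j ℕ.+ suc j)) j (U ℕ.∸ suc j) n N (L (suc j))
    (poly-ev (Φ n)) (Cyclotomic.∣x^n-1 cyc) (x^i-1-coprime cyc 0<n) n≡ (ℕₚ.m∸n+n≡m j≤U) (N≡ j≤U) (L≡ j≤U)
    where
    cyc = Φ-cyclotomic 0<n
    j≤U = ℕₚ.≤-trans j<h h≤U
    2j≤n : suc j ℕ.+ suc j ≤ n
    2j≤n = ℕₚ.≤-trans (ℕₚ.≤-reflexive (double (suc j))) (ℕₚ.≤-trans (ℕₚ.*-monoˡ-≤ 2 j<h) (m/n*n≤m n 2))
      where
      double : ∀ j → j ℕ.+ j ≡ j ℕ.* 2
      double = ℕ-Solver.solve-∀
    -- The remainder r = n - 2 (j + 1) is a genuine difference because j < n / 2.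
    n≡ : n ≡ n ℕ.∸ (suc j ℕ.+ suc j) +2* suc j
    n≡ = sym (trans (+2*-correct (n ℕ.∸ (suc j ℕ.+ suc j)) (suc j))
      (trans (ℕₚ.+-assoc (n ℕ.∸ (suc j ℕ.+ suc j)) (suc j) (suc j)) (ℕₚ.m∸n+n≡m 2j≤n)))

  T0'-congruence : CongMod (T0' a b n) (RHS a b n) (Φ n ⊗ Φ n)
  T0'-congruence = congMod (T0' a b n) (RHS a b n) (Φ n ⊗ Φ n) (negligible-≐ difference
    (negligible-Σ< h (λ j x → sgn U * δ j x) (poly-ev (Φ n ⊗ Φ n)) λ j j<h → negligible-scale (sgn U)
      (negligible-modulus (λ x _ → sym (ev-⊗ (Φ n) (Φ n) x)) (δ-negligible j j<h))))

theorem1p4 : (a b n : ℕ) → 0 < b → b < a → 0 < n →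
    CongMod (T0' a b n) (RHS a b n) (Φ n ⊗ Φ n)
theorem1p4 a b n _ b<a 0<n = subst (λ a → CongMod (T0' a b n) (RHS a b n) (Φ n ⊗ Φ n))
  (trans (ℕₚ.+-suc b (a ℕ.∸ suc b)) (ℕₚ.m+[n∸m]≡n b<a)) (T0'-congruence b (a ℕ.∸ suc b) n 0<n)
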